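{- Every GaTEx graph $G$ has twin-width at most $1$. In particular, for a GaTEx graph $G$, $\mathrm{tww}(G)=1$ if and only if $G$ is not a cograph.
   Context: All graphs are finite, simple and undirected. A cograph is a graph with no induced path on four vertices. A galled-tree on a finite nonempty set $X$ is a directed acyclic graph $N=(V,E)$ such that either $V=X=\{x\}$ and $E=\emptyset$, or: (N1) there is a unique root with indegree 0 and outdegree at least 2; (N2) $x\in X$ iff $x$ has outdegree 0 and indegree 1; (N3) every non-root $v\in V\setminus X$ has either indegree 1 and outdegree at least 2, or indegree 2 and outdegree at least 1 (hybrid-vertex); (N4) each biconnected component $C$ of $N$ contains at most one hybrid-vertex whose two in-neighbours both belong to $C$. For $x,y\in X$, $\mathrm{lca}_N(x,y)$ is the (unique) minimal common ancestor of $x,y$. A labeled galled-tree $(N,t)$ has $t:V\to\{0,1,\odot\}$ with $t(x)=\odot$ iff $x\in X$; it explains the graph on $X$ where $\{x,y\}$ is an edge iff $t(\mathrm{lca}_N(x,y))=1$. A graph is GaTEx if it is isomorphic to a graph explained by some labeled galled-tree. Twin-width: a trigraph is a graph whose edges are partitioned into black and red edges; red degree is degree in the red edges. Contracting $u,v$ yields a new vertex $w$ replacing them, where for each other vertex $x$: $\{w,x\}$ is black if $\{u,x\}$ and $\{v,x\}$ are both black, absent if neither is an edge, and red otherwise. A graph on $n$ vertices (all edges black) is $d$-collapsible if there is a sequence of contractions $G=G_n,\dots,G_1$ to a single vertex with every $G_i$ of maximum red degree at most $d$; $\mathrm{tww}(G)$ is the least such $d$. -}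

module Defs where

open import Data.Nat using (ℕ; zero; suc; _+_; _≤_; _<_)
open import Data.Fin using (Fin; punchIn; _≟_)
import Data.Fin as F
open import Data.Fin.Subset using (Subset; _∈_; _∉_; _⊆_)
open import Data.Bool using (Bool; true; false; if_then_else_)
open import Data.Product using (Σ; ∃; _×_; _,_)
open import Data.Sum using (_⊎_)
open import Relation.Nullary using (¬_; does)
open import Relation.Binary.PropositionalEquality using (_≡_; _≢_)
open import Function.Bundles using (_⇔_)

record Graph (n : ℕ) : Set where
  field
    adj   : Fin n → Fin n → Bool
    sym   : ∀ x y → adj x y ≡ adj y x
    irrefl : ∀ x → adj x x ≡ false
open Graph public

count : ∀ {k} → (Fin k → Bool) → ℕ
count {zero}  p = 0
count {suc k} p = (if p F.zero then 1 else 0) + count (λ i → p (F.suc i))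

-- Cographs: no induced path on four vertices a - b - c - d
-- (distinctness of a,b,c,d is implied by the edge / non-edge pattern)

InducedP4 : ∀ {n} → Graph n → Fin n → Fin n → Fin n → Fin n → Set
InducedP4 G a b c d =
  adj G a b ≡ true × adj G b c ≡ true × adj G c d ≡ true ×
  adj G a c ≡ false × adj G b d ≡ false × adj G a d ≡ false

IsCograph : ∀ {n} → Graph n → Set
IsCograph {n} G = ¬ (Σ (Fin n) λ a → Σ (Fin n) λ b → Σ (Fin n) λ c → Σ (Fin n) λ d →
                      InducedP4 G a b c d)

data Colour : Set where
  none black red : Colour

-- a trigraph on Fin m: colour of each pair (symmetric, none on the diagonal)
Trigraph : ℕ → Set
Trigraph m = Fin m → Fin m → Colour

isRed : Colour → Bool
isRed red = true
isRed _   = false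

redDeg : ∀ {m} → Trigraph m → Fin m → ℕ
redDeg T x = count (λ y → isRed (T x y))

MaxRedDeg≤ : ∀ {m} → ℕ → Trigraph m → Set
MaxRedDeg≤ d T = ∀ x → redDeg T x ≤ d

merge : Colour → Colour → Colour
merge black black = black
merge none  none  = none
merge _     _     = red

-- contract u and v (u ≢ v) in a trigraph on Fin (suc m): vertex v is deleted,
-- vertex u plays the role of the new vertex w; the remaining vertices are
-- indexed by Fin m via punchIn v.
contract : ∀ {m} → Trigraph (suc m) → Fin (suc m) → Fin (suc m) → Trigraph m
contract T u v x y =
  let x' = punchIn v x ; y' = punchIn v y in
  if does (x' ≟ u)
    then (if does (y' ≟ u) then none else merge (T u y') (T v y'))
    else (if does (y' ≟ u) then merge (T x' u) (T x' v) else T x' y')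

data Collapses (d : ℕ) : ∀ {m} → Trigraph (suc m) → Set where
  done : (T : Trigraph 1) → Collapses d T
  step : ∀ {m} (T : Trigraph (suc (suc m))) (u v : Fin (suc (suc m))) → u ≢ v →
         MaxRedDeg≤ d (contract T u v) →
         Collapses d (contract T u v) → Collapses d T

toTrigraph : ∀ {n} → Graph n → Trigraph n
toTrigraph G x y = if adj G x y then black else none

Collapsible : ∀ {n} → ℕ → Graph (suc n) → Set
Collapsible d G = MaxRedDeg≤ d (toTrigraph G) × Collapses d (toTrigraph G)

TwinWidthIs : ∀ {n} → Graph (suc n) → ℕ → Set
TwinWidthIs G d = Collapsible d G × (∀ d' → d' < d → ¬ Collapsible d' G)

Digraph : ℕ → Set
Digraph k = Fin k → Fin k → Bool

indeg outdeg : ∀ {k} → Digraph k → Fin k → ℕ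
indeg  E v = count (λ u → E u v)
outdeg E v = count (λ u → E v u)

data Reach {k} (E : Digraph k) : Fin k → Fin k → Set where
  here  : ∀ {u} → Reach E u u
  there : ∀ {u w v} → E u w ≡ true → Reach E w v → Reach E u v

Acyclic : ∀ {k} → Digraph k → Set
Acyclic E = ∀ u v → E u v ≡ true → ¬ Reach E v u

IsMinCommonAnc : ∀ {k} → Digraph k → Fin k → Fin k → Fin k → Set
IsMinCommonAnc E a b w =
  Reach E w a × Reach E w b ×
  (∀ w' → Reach E w' a → Reach E w' b → Reach E w w' → w' ≡ w)

IsLca : ∀ {k} → Digraph k → Fin k → Fin k → Fin k → Set
IsLca E a b w = IsMinCommonAnc E a b w × (∀ w' → IsMinCommonAnc E a b w' → w' ≡ w)

UAdj : ∀ {k} → Digraph k → Fin k → Fin k → Set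
UAdj E u v = (E u v ≡ true) ⊎ (E v u ≡ true)

data PathIn {k} (E : Digraph k) (P : Fin k → Set) : Fin k → Fin k → Set where
  here  : ∀ {u} → P u → PathIn E P u u
  there : ∀ {u w v} → P u → UAdj E u w → PathIn E P w v → PathIn E P u v

ConnectedWithout : ∀ {k} → Digraph k → Subset k → Fin k → Set
ConnectedWithout E S z =
  ∀ u v → u ∈ S → v ∈ S → u ≢ z → v ≢ z → PathIn E (λ w → w ∈ S × w ≢ z) u v

ConnectedIn : ∀ {k} → Digraph k → Subset k → Set
ConnectedIn E S = ∀ u v → u ∈ S → v ∈ S → PathIn E (λ w → w ∈ S) u v

Biconnected : ∀ {k} → Digraph k → Subset k → Set
Biconnected E S = ConnectedIn E S × (∀ z → z ∈ S → ConnectedWithout E S z)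

IsBiconnComponent : ∀ {k} → Digraph k → Subset k → Set
IsBiconnComponent E S = Biconnected E S × (∀ T → S ⊆ T → Biconnected E T → T ⊆ S)

-- Galled-trees with leaf set given by an injection ℓ : Fin n → Fin k

IsLeaf : ∀ {n k} → (Fin n → Fin k) → Fin k → Set
IsLeaf {n} ℓ v = Σ (Fin n) λ x → ℓ x ≡ v

IsHybrid : ∀ {k} → Digraph k → Fin k → Set
IsHybrid E v = indeg E v ≡ 2

HybridOf : ∀ {k} → Digraph k → Subset k → Fin k → Set
HybridOf E C h = h ∈ C × IsHybrid E h × (∀ u → E u h ≡ true → u ∈ C)

record IsGalledTreeGeneral {n k} (E : Digraph k) (ℓ : Fin n → Fin k) : Set where
  field
    acyclic : Acyclic E
    root    : Fin k
    rootIn  : indeg E root ≡ 0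
    rootOut : 2 ≤ outdeg E root
    rootUnique : ∀ v → indeg E v ≡ 0 → v ≡ root
    leafDeg : ∀ x → outdeg E (ℓ x) ≡ 0 × indeg E (ℓ x) ≡ 1
    leafAll : ∀ v → outdeg E v ≡ 0 → indeg E v ≡ 1 → IsLeaf ℓ v
    inner   : ∀ v → v ≢ root → ¬ IsLeaf ℓ v →
              (indeg E v ≡ 1 × 2 ≤ outdeg E v) ⊎ (indeg E v ≡ 2 × 1 ≤ outdeg E v)
    galled  : ∀ C → IsBiconnComponent E C →
              ∀ h₁ h₂ → HybridOf E C h₁ → HybridOf E C h₂ → h₁ ≡ h₂

IsGalledTreeTrivial : ∀ {n k} → Digraph k → (Fin n → Fin k) → Set
IsGalledTreeTrivial {n} {k} E ℓ =
  k ≡ 1 × n ≡ 1 × (∀ u v → E u v ≡ false)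

IsGalledTree : ∀ {n k} → Digraph k → (Fin n → Fin k) → Set
IsGalledTree E ℓ = IsGalledTreeTrivial E ℓ ⊎ IsGalledTreeGeneral E ℓ

data Label : Set where
  l0 l1 ⊙ : Label

-- G is GaTEx: there is a labeled galled-tree (E, t) whose leaf set is the
-- image of an injection ℓ (so G is isomorphic to the explained graph)
IsGaTEx : ∀ {n} → Graph n → Set
IsGaTEx {n} G =
  Σ ℕ λ k → Σ (Digraph k) λ E → Σ (Fin n → Fin k) λ ℓ → Σ (Fin k → Label) λ t →
    (∀ x y → ℓ x ≡ ℓ y → x ≡ y) ×
    IsGalledTree E ℓ ×
    (∀ v → (t v ≡ ⊙) ⇔ IsLeaf ℓ v) ×
    (∀ x y → x ≢ y →
       Σ (Fin k) λ w → IsLca E (ℓ x) (ℓ y) w × ((adj G x y ≡ true) ⇔ (t w ≡ l1)))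

{-# OPTIONS --safe #-}

-- Distinct hybrids of a galled-tree have galls (undirected cycles) sharing at most one vertex,
-- because two biconnected sets with two common vertices lie in one biconnected component. Hence
-- two incomparable ancestors of a leaf lie on the two sides of one gall, determined by either of
-- them. Take the lowest vertex r with two leaves below it that is either the top of a gall or
-- comparable with all ancestors of those leaves. If r is not the top of a gall, all leaves below
-- r have pairwise lca r and are twins. If it is, the hybrid leaf a and the leaves attached to
-- the two sides form a module in which leaves of different sides have lca r, and for x attached
-- above y on one side lca(x,y) = lca(x,a). Contracting one side from below only ever creates a red
-- edge from its lowest leaf x to a; contracting the other side from below into a, and then a into
-- x, keeps {x,a} the only possible red edge. The remaining graph is explained by the same network.
-- A P₄-free module of this shape contains twins, and contracting twins preserves and reflects
-- P₄-freeness, which settles twin-width 0.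

module Submission where

open import Defs
open import Data.Nat using (ℕ; suc)
open import Data.Product using (_×_)
open import Relation.Nullary using (¬_)
open import Function.Bundles using (_⇔_)

open import Algebra.Properties.CommutativeSemigroup using (x∙yz≈y∙xz)
open import Data.Bool using (Bool; true; false; if_then_else_)
import Data.Bool.Properties as Bool
open import Data.Empty using (⊥; ⊥-elim)
open import Data.Fin using (Fin; punchIn; punchOut; _≟_)
import Data.Fin as F
open import Data.Fin.Induction using (spo-wellFounded; spo-noetherian)
open import Data.Fin.Properties using (any?; all?; punchIn-injective; punchInᵢ≢i; punchIn-punchOut)
open import Data.Fin.Subset using (Subset; _∈_; _⊆_; _⊃_; _∪_)
open import Data.Fin.Subset.Induction using (⊃-wellFounded)
open import Data.Fin.Subset.Properties using (_∈?_; x∈p∪q⁻; p⊆p∪q; q⊆p∪q)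
open import Data.Nat using (zero; _+_; _≤_; _<_; z≤n; s≤s)
open import Data.Nat.Induction using (<-wellFounded)
import Data.Nat.Properties as ℕ
open import Data.Product using (Σ; ∃; _,_; proj₁; proj₂)
open import Data.Sum using (_⊎_; inj₁; inj₂; [_,_]′; reduce)
import Data.Sum as Sum
open import Data.Unit using (⊤; tt)
open import Data.Vec using (tabulate)
open import Data.Vec.Properties using (lookup∘tabulate; lookup⇒[]=; []=⇒lookup)
open import Function using (_∘_; id)
open import Function.Bundles using (mk⇔; Equivalence)
open import Induction.WellFounded using (Acc; acc; WellFounded)
open import Relation.Binary using (IsStrictPartialOrder)
open import Relation.Binary.PropositionalEquality
  using (_≡_; _≢_; refl; trans; cong; cong₂; subst; isEquivalence)
  renaming (sym to ≡-sym)
open import Relation.Nullary using (Dec; yes; no; does; contradiction)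
open import Relation.Nullary.Decidable
  using (_×-dec_; _⊎-dec_; _→-dec_; ¬?; map′; decidable-stable; dec-true; dec-false)
open import Relation.Unary using (Decidable)

private variable
  m n : ℕ

-- Counting and extremal elements

bit : Bool → ℕ
bit b = if b then 1 else 0

count-punchIn : ∀ {k} (f : Fin (suc k) → Bool) i →
                count f ≡ bit (f i) + count (f ∘ punchIn i)
count-punchIn f F.zero = refl
count-punchIn {suc k} f (F.suc i) =
  trans (cong (bit (f F.zero) +_) (count-punchIn (f ∘ F.suc) i))
        (x∙yz≈y∙xz ℕ.+-commutativeSemigroup (bit (f F.zero)) (bit (f (F.suc i))) _)

count-true : ∀ {k} (f : Fin (suc k) → Bool) {i} → f i ≡ true →
             count f ≡ suc (count (f ∘ punchIn i))
count-true f {i} fi =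
  trans (count-punchIn f i) (cong (λ b → bit b + count (f ∘ punchIn i)) fi)

1≤count : ∀ {k} (f : Fin k → Bool) {i} → f i ≡ true → 1 ≤ count f
1≤count {suc k} f fi = subst (1 ≤_) (≡-sym (count-true f fi)) (s≤s z≤n)

without : ∀ {k} (f : Fin (suc k) → Bool) {i j} (i≢j : i ≢ j) → f j ≡ true →
          f (punchIn i (punchOut i≢j)) ≡ true
without f i≢j fj = trans (cong f (punchIn-punchOut i≢j)) fj

2≤count : ∀ {k} (f : Fin k → Bool) {i j} → i ≢ j → f i ≡ true → f j ≡ true → 2 ≤ count f
2≤count {suc k} f {i} i≢j fi fj = subst (2 ≤_) (≡-sym (count-true f fi))
  (s≤s (1≤count (f ∘ punchIn i) (without f i≢j fj)))

3≤count : ∀ {k} (f : Fin k → Bool) {i j l} → i ≢ j → i ≢ l → j ≢ l →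
          f i ≡ true → f j ≡ true → f l ≡ true → 3 ≤ count f
3≤count {suc k} f {i} i≢j i≢l j≢l fi fj fl = subst (3 ≤_) (≡-sym (count-true f fi))
  (s≤s (2≤count (f ∘ punchIn i) ne (without f i≢j fj) (without f i≢l fl)))
  where
  ne : punchOut i≢j ≢ punchOut i≢l
  ne e = j≢l (trans (≡-sym (punchIn-punchOut i≢j))
             (trans (cong (punchIn i) e) (punchIn-punchOut i≢l)))

count≡0 : ∀ {k} (f : Fin k → Bool) → (∀ i → f i ≢ true) → count f ≡ 0
count≡0 {zero} f ¬f = refl
count≡0 {suc k} f ¬f with f F.zero in f0
... | true  = contradiction f0 (¬f F.zero)
... | false = count≡0 (f ∘ F.suc) (¬f ∘ F.suc)

count≤1 : ∀ {k} (f : Fin k → Bool) → (∀ i j → f i ≡ true → f j ≡ true → i ≡ j) → count f ≤ 1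
count≤1 {zero}  f unique = z≤n
count≤1 {suc k} f unique with any? (λ i → f i Bool.≟ true)
... | no ¬∃ = subst (_≤ 1) (≡-sym (count≡0 f λ i fi → ¬∃ (i , fi))) z≤n
... | yes (i , fi) = subst (_≤ 1) (≡-sym (trans (count-true f fi)
        (cong suc (count≡0 (f ∘ punchIn i) λ j fj → punchInᵢ≢i i j (unique _ i fj fi)))))
        (s≤s z≤n)

extremal : ∀ {k} {_⊏_ : Fin k → Fin k → Set} → WellFounded _⊏_ → (∀ u v → Dec (u ⊏ v)) →
           {P : Fin k → Set} → Decidable P → ∀ {r} → P r → ∃ λ m → P m × (∀ v → P v → ¬ (v ⊏ m))
extremal {_⊏_ = _⊏_} wf _⊏?_ {P} P? {r} Pr = go (wf r) Pr
  where
  go : ∀ {r} → Acc _⊏_ r → P r → ∃ λ m → P m × (∀ v → P v → ¬ (v ⊏ m))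
  go {r} (acc rs) Pr with any? (λ v → P? v ×-dec (v ⊏? r))
  ... | yes (v , Pv , v⊏r) = go (rs v⊏r) Pv
  ... | no ¬∃ = r , Pr , λ v Pv v⊏r → ¬∃ (v , Pv , v⊏r)

-- Undirected paths and biconnected sets

module _ {k} {E : Digraph k} where

  ptrans : ∀ {P : Fin k → Set} {u v w} → PathIn E P u v → PathIn E P v w → PathIn E P u w
  ptrans (here _)      q = q
  ptrans (there u e p) q = there u e (ptrans p q)

  phead : ∀ {P : Fin k → Set} {u v} → PathIn E P u v → P u
  phead (here u)      = u
  phead (there u _ _) = u

  psym : ∀ {P : Fin k → Set} {u v} → PathIn E P u v → PathIn E P v u
  psym (here u)      = here u
  psym (there u e p) = ptrans (psym p) (there (phead p) (Sum.swap e) (here u))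

  pmap : ∀ {P Q : Fin k → Set} → (∀ {w} → P w → Q w) → ∀ {u v} → PathIn E P u v → PathIn E Q u v
  pmap f (here u)      = here (f u)
  pmap f (there u e p) = there (f u) e (pmap f p)

  viaHub : ∀ {P : Fin k → Set} {c} → (∀ u → P u → PathIn E P u c) →
           ∀ u v → P u → P v → PathIn E P u v
  viaHub toHub u v Pu Pv = ptrans (toHub u Pu) (psym (toHub v Pv))

  -- `Biconnected` only deletes vertices of `S`; deleting a vertex outside `S` leaves all paths
  -- within `S` intact.
  avoiding : ∀ {S} → Biconnected E S → ∀ z → ConnectedWithout E S z
  avoiding {S} (conn , bic) z u v u∈ v∈ u≢ v≢ with z ∈? S
  ... | yes z∈ = bic z z∈ u v u∈ v∈ u≢ v≢
  ... | no  z∉ = pmap (λ w∈ → w∈ , λ { refl → z∉ w∈ }) (conn u v u∈ v∈)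

  -- Whichever vertex is deleted, one of `s` and `t` survives and joins the rest of `S` to the rest
  -- of `T`.
  union-biconnected : ∀ {S T s t} → Biconnected E S → Biconnected E T → s ≢ t →
    s ∈ S → s ∈ T → t ∈ S → t ∈ T → Biconnected E (S ∪ T)
  union-biconnected {S} {T} {s} {t} bS bT s≢t sS sT tS tT = conn , without-z
    where
    conn : ConnectedIn E (S ∪ T)
    conn u v u∈ v∈ = viaHub {c = s} (λ u u∈ → [ (λ uS → pmap (p⊆p∪q T) (proj₁ bS u s uS sS))
                          , (λ uT → pmap (q⊆p∪q S T) (proj₁ bT u s uT sT)) ]′ (x∈p∪q⁻ S T u∈)) u v u∈ v∈

    through : ∀ c z → c ≢ z → c ∈ S → c ∈ T → ConnectedWithout E (S ∪ T) z
    through c z c≢z cS cT u v u∈ v∈ u≢ v≢ =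
      viaHub {P = λ w → w ∈ (S ∪ T) × w ≢ z} {c = c} (λ { u (u∈ , u≢) →
        [ (λ uS → pmap (λ { (w∈ , w≢) → p⊆p∪q T w∈ , w≢ }) (avoiding bS z u c uS cS u≢ c≢z))
        , (λ uT → pmap (λ { (w∈ , w≢) → q⊆p∪q S T w∈ , w≢ }) (avoiding bT z u c uT cT u≢ c≢z))
        ]′ (x∈p∪q⁻ S T u∈) }) u v (u∈ , u≢) (v∈ , v≢)

    without-z : ∀ z → z ∈ (S ∪ T) → ConnectedWithout E (S ∪ T) z
    without-z z _ with s ≟ z
    ... | no  s≢z = through s z s≢z sS sT
    ... | yes refl = through t z (s≢t ∘ ≡-sym) tS tT

  -- The double negation replaces a decision procedure for biconnectivity.
  extend-to-component : ∀ S → Biconnected E S → ¬ ¬ (∃ λ C → S ⊆ C × IsBiconnComponent E C)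
  extend-to-component S = go S (⊃-wellFounded S)
    where
    go : ∀ S → Acc _⊃_ S → Biconnected E S → ¬ ¬ (∃ λ C → S ⊆ C × IsBiconnComponent E C)
    go S (acc rs) bS ¬∃ = ¬∃ (S , id , bS , maximal)
      where
      maximal : ∀ T → S ⊆ T → Biconnected E T → T ⊆ S
      maximal T S⊆T bT {x} x∈T with x ∈? S
      ... | yes x∈S = x∈S
      ... | no  x∉S = ⊥-elim (go T (rs (S⊆T , x , x∈T , x∉S)) bT
                        λ { (C , T⊆C , comp) → ¬∃ (C , T⊆C ∘ S⊆T , comp) })

module _ {k} {P : Fin k → Set} (P? : Decidable P) where

  subsetOf : Subset k
  subsetOf = tabulate (does ∘ P?)

  ∈-subsetOf⁺ : ∀ {v} → P v → v ∈ subsetOf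
  ∈-subsetOf⁺ {v} Pv = lookup⇒[]= v _ (trans (lookup∘tabulate _ v) (dec-true (P? v) Pv))

  ∈-subsetOf⁻ : ∀ {v} → v ∈ subsetOf → P v
  ∈-subsetOf⁻ {v} v∈ with P? v in eq
  ... | yes Pv = Pv
  ... | no _ = contradiction
        (trans (≡-sym (cong does eq)) (trans (≡-sym (lookup∘tabulate _ v)) ([]=⇒lookup v∈))) λ ()

-- Reachability in an acyclic digraph

module Dag {k} (E : Digraph k) (acyclic : Acyclic E) where

  infix 4 _⇝_ _⇝?_ _⊐_ _⊏_

  _⇝_ : Fin k → Fin k → Set
  _⇝_ = Reach E

  infixr 5 _++_
  _++_ : ∀ {u v w} → u ⇝ v → v ⇝ w → u ⇝ w
  here      ++ q = q
  there e p ++ q = there e (p ++ q)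

  edge : ∀ {u v} → E u v ≡ true → u ⇝ v
  edge e = there e here

  antisym : ∀ {u v} → u ⇝ v → v ⇝ u → u ≡ v
  antisym here        _ = refl
  antisym (there e p) q = ⊥-elim (acyclic _ _ e (p ++ q))

  edge-≢ : ∀ {u v} → E u v ≡ true → u ≢ v
  edge-≢ e refl = acyclic _ _ e here

  lastEdge : ∀ {u v} → u ⇝ v → u ≡ v ⊎ ∃ λ w → u ⇝ w × E w v ≡ true
  lastEdge here = inj₁ refl
  lastEdge (there e p) with lastEdge p
  ... | inj₁ refl         = inj₂ (_ , here , e)
  ... | inj₂ (w , q , e′) = inj₂ (w , there e q , e′)

  _⊐_ _⊏_ : Fin k → Fin k → Set
  u ⊐ v = u ⇝ v × u ≢ v
  u ⊏ v = v ⊐ u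

  ⊐-isStrictPartialOrder : IsStrictPartialOrder _≡_ _⊐_
  ⊐-isStrictPartialOrder = record
    { isEquivalence = isEquivalence
    ; irrefl        = λ { refl (_ , u≢u) → u≢u refl }
    ; trans         = λ { (p , u≢v) (q , _) → p ++ q , λ { refl → u≢v (antisym p q) } }
    ; <-resp-≈      = (λ { refl x → x }) , (λ { refl x → x })
    }

  ⊐-wellFounded : WellFounded _⊐_
  ⊐-wellFounded = spo-wellFounded ⊐-isStrictPartialOrder

  ⊏-wellFounded : WellFounded _⊏_
  ⊏-wellFounded = spo-noetherian ⊐-isStrictPartialOrder

  _⇝?_ : ∀ u v → Dec (u ⇝ v)
  u ⇝? v = go (⊏-wellFounded u)
    where
    go : ∀ {u} → Acc _⊏_ u → Dec (u ⇝ v)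
    go {u} (acc rs) with u ≟ v
    ... | yes refl = yes here
    ... | no u≢v = map′ (λ { (w , e , p) → there e p })
                        (λ { here → contradiction refl u≢v ; (there e p) → _ , e , p })
                        (any? via)
      where
      via : ∀ w → Dec (E u w ≡ true × w ⇝ v)
      via w with E u w Bool.≟ true
      ... | no ¬e = no (¬e ∘ proj₁)
      ... | yes e = map′ (e ,_) proj₂ (go (rs (edge e , edge-≢ e)))

  _⊐?_ : ∀ u v → Dec (u ⊐ v)
  u ⊐? v = (u ⇝? v) ×-dec ¬? (u ≟ v)

  lowest : {P : Fin k → Set} → Decidable P → ∀ {r} → P r →
           ∃ λ m → r ⇝ m × P m × (∀ v → P v → m ⇝ v → m ≡ v)
  lowest {P} P? {r} Pr
    with extremal ⊏-wellFounded (λ u v → v ⊐? u) {P = λ m → r ⇝ m × P m}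
           (λ m → (r ⇝? m) ×-dec P? m) (here , Pr)
  ... | m , (r⇝m , Pm) , min = m , r⇝m , Pm ,
        λ v Pv m⇝v → decidable-stable (m ≟ v) λ m≢v → min v (r⇝m ++ m⇝v , Pv) (m⇝v , m≢v)

  highest : {P : Fin k → Set} → Decidable P → ∀ {r} → P r →
            ∃ λ m → m ⇝ r × P m × (∀ v → P v → v ⇝ m → v ≡ m)
  highest {P} P? {r} Pr
    with extremal ⊐-wellFounded _⊐?_ {P = λ m → m ⇝ r × P m}
           (λ m → (m ⇝? r) ×-dec P? m) (here , Pr)
  ... | m , (m⇝r , Pm) , max = m , m⇝r , Pm ,
        λ v Pv v⇝m → decidable-stable (v ≟ m) λ v≢m → max v (v⇝m ++ m⇝r , Pv) (v⇝m , v≢m)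

  directed : ∀ {P : Fin k → Set} {u v} → u ⇝ v → (∀ w → u ⇝ w → w ⇝ v → P w) → PathIn E P u v
  directed here        inside = here (inside _ here here)
  directed (there e p) inside =
    there (inside _ here (there e p)) (inj₁ e) (directed p λ w q → inside w (there e q))

-- Galls

module GalledTree {n k} {E : Digraph k} {ℓ : Fin n → Fin k} (N : IsGalledTreeGeneral E ℓ) where

  open IsGalledTreeGeneral N
  open Dag E acyclic

  -- A topmost ancestor of `v` has no parent, and only the root has indegree 0.
  root-⇝ : ∀ v → root ⇝ v
  root-⇝ v with highest {P = λ _ → ⊤} (λ _ → yes tt) {r = v} tt
  ... | m , m⇝v , _ , top with rootUnique m
          (count≡0 (λ u → E u m) λ u e → edge-≢ e (top u tt (edge e)))
  ... | refl = m⇝v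

  -- Two parents exclude the root, the leaves and the tree vertices; the remaining case has indegree
  -- exactly 2.
  indeg-two-parents : ∀ {p q h} → p ≢ q → E p h ≡ true → E q h ≡ true → indeg E h ≡ 2
  indeg-two-parents {p} {q} {h} p≢q ph qh with h ≟ root
  ... | yes refl = contradiction (subst (2 ≤_) rootIn (2≤count (λ u → E u h) p≢q ph qh)) λ ()
  ... | no h≢root with any? (λ x → ℓ x ≟ h)
  ...   | yes (x , refl) = contradiction
            (subst (2 ≤_) (proj₂ (leafDeg x)) (2≤count (λ u → E u h) p≢q ph qh)) λ { (s≤s ()) }
  ...   | no ¬leaf with inner h h≢root ¬leaf
  ...     | inj₁ (d , _) = contradiction
              (subst (2 ≤_) d (2≤count (λ u → E u h) p≢q ph qh)) λ { (s≤s ()) }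
  ...     | inj₂ (d , _) = d

  third-parent : ∀ {p q h w} → p ≢ q → E p h ≡ true → E q h ≡ true → E w h ≡ true → w ≡ p ⊎ w ≡ q
  third-parent {p} {q} {h} {w} p≢q ph qh wh with w ≟ p | w ≟ q
  ... | yes w≡p | _ = inj₁ w≡p
  ... | no _ | yes w≡q = inj₂ w≡q
  ... | no w≢p | no w≢q = contradiction
        (subst (3 ≤_) (indeg-two-parents p≢q ph qh)
          (3≤count (λ u → E u h) p≢q (w≢p ∘ ≡-sym) (w≢q ∘ ≡-sym) ph qh wh))
        λ { (s≤s (s≤s ())) }

  -- The top `r` may coincide with `p` or `q`; that side is then a single edge to `h`.
  record Gall (r h p q : Fin k) : Set where
    constructor gall
    field
      p≢q   : p ≢ q
      ph    : E p h ≡ true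
      qh    : E q h ≡ true
      r⇝p   : r ⇝ p
      r⇝q   : r ⇝ q
      r-low : ∀ z → z ⇝ p → z ⇝ q → r ⇝ z → r ≡ z

  swap : ∀ {r h p q} → Gall r h p q → Gall r h q p
  swap (gall p≢q ph qh r⇝p r⇝q r-low) =
    gall (p≢q ∘ ≡-sym) qh ph r⇝q r⇝p λ z zq zp → r-low z zp zq

  module _ {r h p q} (K : Gall r h p q) where
    open Gall K

    -- All vertices between `r` and a parent of `h` are taken, not one chosen path: that each side
    -- is a chain is only deduced later, from the biconnectedness of this set.
    OnGall : Fin k → Set
    OnGall v = v ≡ h ⊎ (r ⇝ v × (v ⇝ p ⊎ v ⇝ q))

    onGall? : Decidable OnGall
    onGall? v = (v ≟ h) ⊎-dec ((r ⇝? v) ×-dec ((v ⇝? p) ⊎-dec (v ⇝? q)))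

    gallSet : Subset k
    gallSet = subsetOf onGall?

    -- z may lie on one of the two sides, but then h is reached from r along the other one.
    top-to-hybrid : ∀ {z} {P : Fin k → Set} → z ≢ r →
      (∀ w → r ⇝ w → w ⇝ p ⊎ w ⇝ q → w ≢ z → P w) → P h → PathIn E P r h
    top-to-hybrid {z} {P} z≢r inside Ph with z ⇝? p
    ... | no ¬z⇝p = ptrans
          (directed r⇝p λ w r⇝w w⇝p → inside w r⇝w (inj₁ w⇝p) λ { refl → ¬z⇝p w⇝p })
          (there (inside p r⇝p (inj₁ here) λ { refl → ¬z⇝p here }) (inj₁ ph) (here Ph))
    ... | yes z⇝p = ptrans
          (directed r⇝q λ w r⇝w w⇝q → inside w r⇝w (inj₂ w⇝q) (avoid r⇝w w⇝q))
          (there (inside q r⇝q (inj₂ here) (avoid r⇝q here)) (inj₁ qh) (here Ph))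
      where
      avoid : ∀ {w} → r ⇝ w → w ⇝ q → w ≢ z
      avoid r⇝w w⇝q refl = z≢r (≡-sym (r-low _ z⇝p w⇝q r⇝w))

    -- If `z` is not above `v`, the way from `v` up to `r` avoids it; if it is, acyclicity keeps `z`
    -- off the way down from `v` through `p` to `h`.
    side-to-hub : ∀ {z} {P : Fin k → Set} →
      (∀ w → r ⇝ w → w ⇝ p → w ≢ z → P w) → (z ≢ h → P h) →
      ∀ {v} → r ⇝ v → v ⇝ p → v ≢ z → PathIn E P v r ⊎ (z ≢ h × PathIn E P v h)
    side-to-hub {z} {P} inside Ph {v} r⇝v v⇝p v≢z with z ⇝? v
    ... | no ¬z⇝v = inj₁ (psym (directed r⇝v λ w r⇝w w⇝v →
                      inside w r⇝w (w⇝v ++ v⇝p) λ { refl → ¬z⇝v w⇝v }))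
    ... | yes z⇝v = inj₂ (z≢h , ptrans
            (directed v⇝p λ w v⇝w w⇝p → inside w (r⇝v ++ v⇝w) w⇝p (below v⇝w))
            (there (inside p r⇝p here (below v⇝p)) (inj₁ ph) (here (Ph z≢h))))
      where
      below : ∀ {w} → v ⇝ w → w ≢ z
      below v⇝w refl = v≢z (antisym v⇝w z⇝v)
      z≢h : z ≢ h
      z≢h refl = acyclic _ _ ph (z⇝v ++ v⇝p)

  -- Without the top, every vertex still runs down to the hybrid. Without any other vertex, every
  -- vertex still reaches the top: directly, or down to the hybrid and up the side that is still
  -- intact.
  gall-biconnected : ∀ {r h p q} (K : Gall r h p q) → Biconnected E (gallSet K)
  gall-biconnected {r} {h} {p} {q} K = conn , without-z
    where
    open Gall K
    ∈⁺ : ∀ {v} → OnGall K v → v ∈ gallSet K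
    ∈⁺ = ∈-subsetOf⁺ (onGall? K)
    ∈⁻ : ∀ {v} → v ∈ gallSet K → OnGall K v
    ∈⁻ = ∈-subsetOf⁻ (onGall? K)
    h∈ : h ∈ gallSet K
    h∈ = ∈⁺ (inj₁ refl)

    conn : ConnectedIn E (gallSet K)
    conn u v u∈ v∈ = viaHub {c = h} (λ u u∈ → toHybrid (∈⁻ u∈)) u v u∈ v∈
      where
      toHybrid : ∀ {u} → OnGall K u → PathIn E (_∈ gallSet K) u h
      toHybrid (inj₁ refl) = here h∈
      toHybrid (inj₂ (r⇝u , inj₁ u⇝p)) = ptrans
        (directed u⇝p λ w u⇝w w⇝p → ∈⁺ (inj₂ (r⇝u ++ u⇝w , inj₁ w⇝p)))
        (there (∈⁺ (inj₂ (r⇝p , inj₁ here))) (inj₁ ph) (here h∈))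
      toHybrid (inj₂ (r⇝u , inj₂ u⇝q)) = ptrans
        (directed u⇝q λ w u⇝w w⇝q → ∈⁺ (inj₂ (r⇝u ++ u⇝w , inj₂ w⇝q)))
        (there (∈⁺ (inj₂ (r⇝q , inj₂ here))) (inj₁ qh) (here h∈))

    without-z : ∀ z → z ∈ gallSet K → ConnectedWithout E (gallSet K) z
    without-z z _ u v u∈ v∈ u≢ v≢ with z ≟ r
    ... | yes refl = viaHub {c = h} toHybrid u v (u∈ , u≢) (v∈ , v≢)
      where
      h≢r : h ≢ r
      h≢r refl = acyclic _ _ ph r⇝p
      down : ∀ {P : Fin k → Set} {u} → PathIn E P u r ⊎ (z ≢ h × PathIn E P u h) → ¬ P r → PathIn E P u h
      down (inj₁ path) ¬Pr = contradiction (phead (psym path)) ¬Pr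
      down (inj₂ (_ , path)) _ = path
      toHybrid : ∀ u → (u ∈ gallSet K × u ≢ r) → PathIn E (λ w → w ∈ gallSet K × w ≢ r) u h
      toHybrid u (u∈ , u≢) with ∈⁻ u∈
      ... | inj₁ refl = here (h∈ , h≢r)
      ... | inj₂ (r⇝u , inj₁ u⇝p) = down (side-to-hub K
              (λ w r⇝w w⇝p w≢ → ∈⁺ (inj₂ (r⇝w , inj₁ w⇝p)) , w≢) (λ _ → h∈ , h≢r)
              r⇝u u⇝p u≢) λ { (_ , r≢r) → r≢r refl }
      ... | inj₂ (r⇝u , inj₂ u⇝q) = down (side-to-hub (swap K)
              (λ w r⇝w w⇝q w≢ → ∈⁺ (inj₂ (r⇝w , inj₂ w⇝q)) , w≢) (λ _ → h∈ , h≢r)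
              r⇝u u⇝q u≢) λ { (_ , r≢r) → r≢r refl }
    ... | no z≢r = viaHub {c = r} toTop u v (u∈ , u≢) (v∈ , v≢)
      where
      P : Fin k → Set
      P w = w ∈ gallSet K × w ≢ z
      hybrid-to-top : z ≢ h → PathIn E P h r
      hybrid-to-top z≢h = psym (top-to-hybrid K z≢r
        (λ w r⇝w side w≢ → ∈⁺ (inj₂ (r⇝w , side)) , w≢) (h∈ , z≢h ∘ ≡-sym))
      up : ∀ {u} → PathIn E P u r ⊎ (z ≢ h × PathIn E P u h) → PathIn E P u r
      up (inj₁ path) = path
      up (inj₂ (z≢h , path)) = ptrans path (hybrid-to-top z≢h)
      toTop : ∀ u → P u → PathIn E P u r
      toTop u (u∈ , u≢) with ∈⁻ u∈
      ... | inj₁ refl = hybrid-to-top (u≢ ∘ ≡-sym)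
      ... | inj₂ (r⇝u , inj₁ u⇝p) = up (side-to-hub K
              (λ w r⇝w w⇝p w≢ → ∈⁺ (inj₂ (r⇝w , inj₁ w⇝p)) , w≢) (λ z≢h → h∈ , z≢h ∘ ≡-sym)
              r⇝u u⇝p u≢)
      ... | inj₂ (r⇝u , inj₂ u⇝q) = up (side-to-hub (swap K)
              (λ w r⇝w w⇝q w≢ → ∈⁺ (inj₂ (r⇝w , inj₂ w⇝q)) , w≢) (λ z≢h → h∈ , z≢h ∘ ≡-sym)
              r⇝u u⇝q u≢)

  -- The union of both galls is biconnected, so one component contains both hybrids with all their
  -- parents, and (N4) identifies them. Equality of vertices is decidable, so the doubly negated
  -- component suffices.
  galls-share : ∀ {r h p q r′ h′ p′ q′ s t} (K : Gall r h p q) (K′ : Gall r′ h′ p′ q′) → s ≢ t →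
    OnGall K s → OnGall K′ s → OnGall K t → OnGall K′ t → h ≡ h′
  galls-share {h = h} {h′ = h′} K K′ s≢t sK sK′ tK tK′ = decidable-stable (h ≟ h′) λ h≢h′ →
    extend-to-component _
      (union-biconnected (gall-biconnected K) (gall-biconnected K′) s≢t
        (∈-subsetOf⁺ (onGall? K) sK) (∈-subsetOf⁺ (onGall? K′) sK′)
        (∈-subsetOf⁺ (onGall? K) tK) (∈-subsetOf⁺ (onGall? K′) tK′))
      λ { (C , ⊆C , comp) → h≢h′ (galled C comp h h′
            (hybridOf K (⊆C ∘ p⊆p∪q (gallSet K′)))
            (hybridOf K′ (⊆C ∘ q⊆p∪q (gallSet K) (gallSet K′)))) }
    where
    hybridOf : ∀ {r h p q C} (K : Gall r h p q) → gallSet K ⊆ C → HybridOf E C h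
    hybridOf {h = h} {C = C} K K⊆C = K⊆C (∈-subsetOf⁺ (onGall? K) (inj₁ refl)) ,
                     indeg-two-parents p≢q ph qh , parent
      where
      open Gall K
      parent : ∀ w → E w h ≡ true → w ∈ C
      parent w wh with third-parent p≢q ph qh wh
      ... | inj₁ refl = K⊆C (∈-subsetOf⁺ (onGall? K) (inj₂ (r⇝p , inj₁ here)))
      ... | inj₂ refl = K⊆C (∈-subsetOf⁺ (onGall? K) (inj₂ (r⇝q , inj₂ here)))

  gall-of-hybrid : ∀ {h p q} → p ≢ q → E p h ≡ true → E q h ≡ true → ∃ λ r → Gall r h p q
  gall-of-hybrid {h} {p} {q} p≢q ph qh
    with lowest {P = λ z → z ⇝ p × z ⇝ q} (λ z → (z ⇝? p) ×-dec (z ⇝? q)) (root-⇝ p , root-⇝ q)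
  ... | r , _ , (r⇝p , r⇝q) , r-low = r , gall p≢q ph qh r⇝p r⇝q λ z zp zq → r-low z (zp , zq)

  -- For a gall with top r and a parent p of its hybrid: the vertices of that side except the top.
  infix 4 _∈⟨_,_]
  _∈⟨_,_] : Fin k → Fin k → Fin k → Set
  v ∈⟨ r , p ] = r ⇝ v × v ⇝ p × r ≢ v

  -- A second parent of `v` would make `v` the hybrid of another gall sharing the edge from `w` to
  -- `v` with this one. Then `h` would equal `v`, which lies above the parent `p` of `h`.
  unique-parent : ∀ {r h p q} → Gall r h p q → ∀ {u u′ v} → v ∈⟨ r , p ] →
                  E u v ≡ true → E u′ v ≡ true → u ≡ u′
  unique-parent {r} {h} {p} {q} K {u} {u′} {v} (r⇝v , v⇝p , r≢v) uv u′v
    with lastEdge r⇝v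
  ... | inj₁ r≡v = contradiction r≡v r≢v
  ... | inj₂ (w , r⇝w , wv) = trans (agree uv) (≡-sym (agree u′v))
    where
    agree : ∀ {x} → E x v ≡ true → x ≡ w
    agree {x} xv = decidable-stable (x ≟ w) λ x≢w →
      let (_ , K′) = gall-of-hybrid x≢w xv wv
          h≡v = galls-share K K′ (edge-≢ wv)
                  (inj₂ (r⇝w , inj₁ (edge wv ++ v⇝p))) (inj₂ (Gall.r⇝q K′ , inj₂ here))
                  (inj₂ (r⇝v , inj₁ v⇝p)) (inj₁ refl)
      in acyclic _ _ (Gall.ph K) (subst (_⇝ p) (≡-sym h≡v) v⇝p)

  -- Both paths to `v` enter it through its unique parent, so they can be followed upwards together
  -- until one of `x` and `z` is met.
  side-chain : ∀ {r h p q} → Gall r h p q → ∀ {v x z} → v ⇝ p → r ⇝ x → x ⇝ v → z ⇝ v →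
               x ⇝ z ⊎ z ⇝ x
  side-chain {r} K {v} {x} {z} v⇝p r⇝x x⇝v z⇝v = go (⊐-wellFounded v) v⇝p x⇝v z⇝v
    where
    go : ∀ {v} → Acc _⊐_ v → v ⇝ _ → x ⇝ v → z ⇝ v → x ⇝ z ⊎ z ⇝ x
    go (acc rs) v⇝p x⇝v z⇝v with lastEdge x⇝v | lastEdge z⇝v
    ... | inj₁ refl | _ = inj₂ z⇝v
    ... | inj₂ _ | inj₁ refl = inj₁ x⇝v
    ... | inj₂ (w , x⇝w , wv) | inj₂ (w′ , z⇝w′ , w′v)
      with unique-parent K (r⇝x ++ x⇝v , v⇝p , λ { refl → acyclic _ _ wv (r⇝x ++ x⇝w) }) wv w′v
    ... | refl = go (rs (edge wv , edge-≢ wv)) (edge wv ++ v⇝p) x⇝w z⇝w′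

  -- Take a highest common descendant `h` of `u` and `v` above `a`. The paths from `u` and `v` enter
  -- it through different parents, since a common one would be a higher common descendant; for the
  -- same reason `u` and `v` lie strictly below the top.
  gall-of-incomparable : ∀ {u v a} → ¬ u ⇝ v → ¬ v ⇝ u → u ⇝ a → v ⇝ a →
    ∃ λ r → ∃ λ h → ∃ λ p → ∃ λ q → Gall r h p q × h ⇝ a × u ∈⟨ r , p ] × v ∈⟨ r , q ]
  gall-of-incomparable {u} {v} {a} u⇝̸v v⇝̸u u⇝a v⇝a
    with highest {P = λ h → u ⇝ h × v ⇝ h} (λ h → (u ⇝? h) ×-dec (v ⇝? h)) (u⇝a , v⇝a)
  ... | h , h⇝a , (u⇝h , v⇝h) , h-high with lastEdge u⇝h | lastEdge v⇝h
  ...   | inj₁ refl | _ = contradiction v⇝h v⇝̸u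
  ...   | inj₂ _ | inj₁ refl = contradiction u⇝h u⇝̸v
  ...   | inj₂ (p , u⇝p , ph) | inj₂ (q , v⇝q , qh) with gall-of-hybrid p≢q ph qh
    where
    none-above : ∀ {w} → E w h ≡ true → u ⇝ w → v ⇝ w → ⊥
    none-above wh u⇝w v⇝w = edge-≢ wh (h-high _ (u⇝w , v⇝w) (edge wh))
    p≢q : p ≢ q
    p≢q refl = none-above ph u⇝p v⇝q
  ... | r , K = r , h , p , q , K , h⇝a , u-side , v-side
    where
    open Gall K using (r⇝p; r⇝q)
    none-above : ∀ {w} → E w h ≡ true → u ⇝ w → v ⇝ w → ⊥
    none-above wh u⇝w v⇝w = edge-≢ wh (h-high _ (u⇝w , v⇝w) (edge wh))
    u-side : u ∈⟨ r , p ]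
    u-side with side-chain K here here r⇝p u⇝p
    ... | inj₂ u⇝r = ⊥-elim (none-above qh (u⇝r ++ r⇝q) v⇝q)
    ... | inj₁ r⇝u = r⇝u , u⇝p , λ { refl → none-above qh r⇝q v⇝q }
    v-side : v ∈⟨ r , q ]
    v-side with side-chain (swap K) here here r⇝q v⇝q
    ... | inj₂ v⇝r = ⊥-elim (none-above ph u⇝p (v⇝r ++ r⇝p))
    ... | inj₁ r⇝v = r⇝v , v⇝q , λ { refl → none-above ph u⇝p r⇝p }

  -- Both galls contain `u` and also its unique parent, hence two common vertices.
  side-determines-hybrid : ∀ {r h p q r′ h′ p′ q′} → Gall r h p q → Gall r′ h′ p′ q′ →
    ∀ {u} → u ∈⟨ r , p ] → u ∈⟨ r′ , p′ ] → h ≡ h′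
  side-determines-hybrid K K′ u-side@(r⇝u , u⇝p , r≢u) u-side′@(r′⇝u , u⇝p′ , r′≢u)
    with lastEdge r⇝u | lastEdge r′⇝u
  ... | inj₁ r≡u | _ = contradiction r≡u r≢u
  ... | inj₂ _ | inj₁ r′≡u = contradiction r′≡u r′≢u
  ... | inj₂ (w , r⇝w , wu) | inj₂ (w′ , r′⇝w′ , w′u) with unique-parent K u-side wu w′u
  ... | refl = galls-share K K′ (edge-≢ wu)
        (inj₂ (r⇝w , inj₁ (edge wu ++ u⇝p))) (inj₂ (r′⇝w′ , inj₁ (edge wu ++ u⇝p′)))
        (inj₂ (r⇝u , inj₁ u⇝p)) (inj₂ (r′⇝u , inj₁ u⇝p′))

  hybrid-not-on-side : ∀ {r h p q r′ h′ p′ q′} → Gall r h p q → Gall r′ h′ p′ q′ →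
                       ¬ h ∈⟨ r′ , p′ ]
  hybrid-not-on-side K K′ h-side = Gall.p≢q K (unique-parent K′ h-side (Gall.ph K) (Gall.qh K))

-- Explained graphs

restrict : ∀ {m n} → Graph n → (Fin m → Fin n) → Graph m
restrict G e = record
  { adj    = λ x y → adj G (e x) (e y)
  ; sym    = λ x y → sym G (e x) (e y)
  ; irrefl = λ x → irrefl G (e x)
  }

Twins : ∀ {n} → Graph n → Fin n → Fin n → Set
Twins G x y = x ≢ y × (∀ z → z ≢ x → z ≢ y → adj G z x ≡ adj G z y)

-- x ≼ y means that x is attached above y, or at the same vertex, on the side S of the gall with hybrid leaf a.
record IsSide {n} (G : Graph n) (a : Fin n) (_≼_ : Fin n → Fin n → Set) (S : Fin n → Set) : Set where
  field
    side?   : Decidable S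
    ≢hybrid : ∀ {x} → S x → x ≢ a
    ≼-total : ∀ {x y} → S x → S y → x ≼ y ⊎ y ≼ x
    upper   : ∀ {x y} → S x → S y → x ≢ y → x ≼ y → adj G x y ≡ adj G x a

-- The leaves hanging below a gall: the hybrid leaf a and the leaves on both sides.
record GallModule {n} (G : Graph n) : Set₁ where
  field
    a          : Fin n
    _≼_        : Fin n → Fin n → Set
    ≼-trans    : ∀ {x y z} → x ≼ y → y ≼ z → x ≼ z
    Left Right : Fin n → Set
    left       : IsSide G a _≼_ Left
    right      : IsSide G a _≼_ Right
    inhabited  : ∃ Left
    disjoint   : ∀ {x} → Left x → ¬ Right x
    colour     : Bool
    cross      : ∀ {x y} → Left x → Right y → adj G x y ≡ colour
    homogeneous : ∀ {x z} → Left x ⊎ Right x → z ≢ a → ¬ Left z → ¬ Right z → adj G z x ≡ adj G z a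

module Explanation {n k} {E : Digraph k} {ℓ : Fin n → Fin k} (N : IsGalledTreeGeneral E ℓ) where

  open IsGalledTreeGeneral N using (acyclic; root)
  open Dag E acyclic
  open GalledTree N

  -- The network stays fixed while leaves are deleted, so leaf need not enumerate all leaves of N.
  record Explains {m} (G : Graph m) : Set where
    field
      leaf    : Fin m → Fin k
      lca     : Fin m → Fin m → Fin k
      lca⇝ˡ   : ∀ x y → lca x y ⇝ leaf x
      lca⇝ʳ   : ∀ x y → lca x y ⇝ leaf y
      lca-low : ∀ {x y z} → z ⇝ leaf x → z ⇝ leaf y → z ⇝ lca x y
      label   : Fin k → Bool
      adj-lca : ∀ {x y} → x ≢ y → adj G x y ≡ label (lca x y)

  explains-restrict : ∀ {m m′} {G : Graph m} (e : Fin m′ → Fin m) → (∀ {x y} → e x ≡ e y → x ≡ y) →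
                      Explains G → Explains (restrict G e)
  explains-restrict e inj X = record
    { leaf = leaf ∘ e ; lca = λ x y → lca (e x) (e y)
    ; lca⇝ˡ = λ x y → lca⇝ˡ (e x) (e y) ; lca⇝ʳ = λ x y → lca⇝ʳ (e x) (e y)
    ; lca-low = lca-low ; label = label ; adj-lca = λ x≢y → adj-lca (x≢y ∘ inj) }
    where open Explains X

  module _ {m} {G : Graph m} (X : Explains G) where
    open Explains X

    adj-cong : ∀ {x y x′ y′} → x ≢ y → x′ ≢ y′ → lca x y ≡ lca x′ y′ → adj G x y ≡ adj G x′ y′
    adj-cong x≢y x′≢y′ e = trans (adj-lca x≢y) (trans (cong label e) (≡-sym (adj-lca x′≢y′)))

    -- Splitting vertices

    Branching : Fin k → Set
    Branching w = ∃ λ x → ∃ λ y → x ≢ y × w ⇝ leaf x × w ⇝ leaf y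

    Crossed : Fin k → Set
    Crossed w = ∃ λ z → ∃ λ x → w ⇝ leaf x × z ⇝ leaf x × ¬ w ⇝ z × ¬ z ⇝ w

    -- Since leaves may have been deleted, the gall must still carry a leaf below its hybrid and
    -- another leaf below a non-top vertex of one side.
    TopOfGall : Fin k → Set
    TopOfGall r = ∃ λ h → ∃ λ p → ∃ λ q → ∃ λ a → ∃ λ x → ∃ λ u →
      Gall r h p q × h ⇝ leaf a × x ≢ a × u ∈⟨ r , p ] × u ⇝ leaf x

    Splitting : Fin k → Set
    Splitting w = Branching w × (¬ Crossed w ⊎ TopOfGall w)

    branching? : Decidable Branching
    branching? w = any? λ x → any? λ y → ¬? (x ≟ y) ×-dec (w ⇝? leaf x) ×-dec (w ⇝? leaf y)

    crossed? : Decidable Crossed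
    crossed? w = any? λ z → any? λ x →
      (w ⇝? leaf x) ×-dec (z ⇝? leaf x) ×-dec ¬? (w ⇝? z) ×-dec ¬? (z ⇝? w)

    gall? : ∀ r h p q → Dec (Gall r h p q)
    gall? r h p q = map′
      (λ { (p≢q , ph , qh , r⇝p , r⇝q , low) → gall p≢q ph qh r⇝p r⇝q low })
      (λ { (gall p≢q ph qh r⇝p r⇝q low) → p≢q , ph , qh , r⇝p , r⇝q , low })
      (¬? (p ≟ q) ×-dec (E p h Bool.≟ true) ×-dec (E q h Bool.≟ true) ×-dec (r ⇝? p) ×-dec (r ⇝? q)
       ×-dec all? (λ z → (z ⇝? p) →-dec (z ⇝? q) →-dec (r ⇝? z) →-dec (r ≟ z)))

    topOfGall? : Decidable TopOfGall
    topOfGall? r = any? λ h → any? λ p → any? λ q → any? λ a → any? λ x → any? λ u →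
      gall? r h p q ×-dec (h ⇝? leaf a) ×-dec ¬? (x ≟ a) ×-dec
      ((r ⇝? u) ×-dec (u ⇝? p) ×-dec ¬? (r ≟ u)) ×-dec (u ⇝? leaf x)

    splitting? : Decidable Splitting
    splitting? w = branching? w ×-dec (¬? (crossed? w) ⊎-dec topOfGall? w)

    -- Of two distinct leaves below `w`, at least one differs from the hybrid leaf `a`; it witnesses
    -- that the side of `w` carries a leaf.
    crossing-gall : ∀ {w} → Branching w → Crossed w →
      ∃ λ r → ∃ λ h → ∃ λ p → ∃ λ q → ∃ λ a → ∃ λ z →
        Gall r h p q × h ⇝ leaf a × w ∈⟨ r , p ] × z ∈⟨ r , q ] × Branching r × TopOfGall r
    crossing-gall {w} (x , y , x≢y , w⇝x , w⇝y) (z , a , w⇝a , z⇝a , w⇝̸z , z⇝̸w)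
      with gall-of-incomparable w⇝̸z z⇝̸w w⇝a z⇝a
    ... | r , h , p , q , K , h⇝a , w-side@(r⇝w , _) , z-side =
      r , h , p , q , a , z , K , h⇝a , w-side , z-side ,
      (x , y , x≢y , r⇝w ++ w⇝x , r⇝w ++ w⇝y) , top
      where
      top : TopOfGall r
      top with x ≟ a
      ... | no x≢a = h , p , q , a , x , w , K , h⇝a , x≢a , w-side , w⇝x
      ... | yes refl = h , p , q , a , y , w , K , h⇝a , x≢y ∘ ≡-sym , w-side , w⇝y

    module Lowest {r} (r-low : ∀ v → Splitting v → r ⇝ v → r ≡ v) where

      below-crossed : ∀ {w} → r ⇝ w → r ≢ w → Branching w → Crossed w
      below-crossed {w} r⇝w r≢w br = decidable-stable (crossed? w) λ ¬cr →
        r≢w (r-low w (br , inj₁ ¬cr) r⇝w)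

      -- A lowest splitting vertex that is not the top of a gall

      module NotTop (¬crossed : ¬ Crossed r) (¬top : ¬ TopOfGall r) where

        comparable : ∀ {x z} → r ⇝ leaf x → z ⇝ leaf x → r ⇝ z ⊎ z ⇝ r
        comparable {x} {z} r⇝x z⇝x with r ⇝? z | z ⇝? r
        ... | yes r⇝z | _ = inj₁ r⇝z
        ... | no _ | yes z⇝r = inj₂ z⇝r
        ... | no r⇝̸z | no z⇝̸r = contradiction (z , x , r⇝x , z⇝x , r⇝̸z , z⇝̸r) ¬crossed

        -- Were the lca `μ` strictly below `r`, it would be crossed and lie on a side of a gall with
        -- splitting top `r′`. As `r` is lowest and not a top itself, `r′` is strictly above `r`.
        -- Comparing `r` with `z` on the other side then makes `r` or `z` a common ancestor of `p`
        -- and `q` below `r′`, against the minimality of `r′`.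
        lca-inside : ∀ {x y} → x ≢ y → r ⇝ leaf x → r ⇝ leaf y → lca x y ≡ r
        lca-inside {x} {y} x≢y r⇝x r⇝y = decidable-stable (lca x y ≟ r) λ μ≢r →
          let μ = lca x y
              r⇝μ = lca-low r⇝x r⇝y
              br = x , y , x≢y , lca⇝ˡ x y , lca⇝ʳ x y
              (r′ , h , p , q , a , z , K , h⇝a , (r′⇝μ , μ⇝p , _) , (r′⇝z , z⇝q , r′≢z) , br′ , top) =
                crossing-gall br (below-crossed r⇝μ (μ≢r ∘ ≡-sym) br)
              open Gall K using (ph; qh) renaming (r-low to r′-low)
              r⇝̸r′ = λ r⇝r′ → ¬top (subst TopOfGall (≡-sym (r-low r′ (br′ , inj₂ top) r⇝r′)) top)
              r⇝p = r⇝μ ++ μ⇝p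
          in [ r⇝̸r′ , (λ r′⇝r →
               [ (λ r⇝z → r⇝̸r′ (subst (r ⇝_) (≡-sym (r′-low r r⇝p (r⇝z ++ z⇝q) r′⇝r)) here))
               , (λ z⇝r → r′≢z (r′-low z (z⇝r ++ r⇝p) z⇝q r′⇝z))
               ]′ (comparable (r⇝p ++ edge ph ++ h⇝a) (z⇝q ++ edge qh ++ h⇝a))) ]′
             (comparable r⇝x (r′⇝μ ++ lca⇝ˡ x y))

        -- The vertex `lca z x` is comparable with `r` but not below it, as `z` is not; being above
        -- `r`, it is also above `y`.
        lca-outside : ∀ {x y z} → r ⇝ leaf x → r ⇝ leaf y → ¬ r ⇝ leaf z → lca z x ⇝ lca z y
        lca-outside {x} {y} {z} r⇝x r⇝y r⇝̸z with comparable r⇝x (lca⇝ʳ z x)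
        ... | inj₁ r⇝μ = contradiction (r⇝μ ++ lca⇝ˡ z x) r⇝̸z
        ... | inj₂ μ⇝r = lca-low (lca⇝ˡ z x) (μ⇝r ++ r⇝y)

        twins : ∀ {x y} → x ≢ y → r ⇝ leaf x → r ⇝ leaf y → Twins G x y
        twins {x} {y} x≢y r⇝x r⇝y = x≢y , agree
          where
          agree : ∀ z → z ≢ x → z ≢ y → adj G z x ≡ adj G z y
          agree z z≢x z≢y with r ⇝? leaf z
          ... | yes r⇝z = adj-cong z≢x z≢y
                (trans (lca-inside z≢x r⇝z r⇝x) (≡-sym (lca-inside z≢y r⇝z r⇝y)))
          ... | no r⇝̸z = adj-cong z≢x z≢y
                (antisym (lca-outside r⇝x r⇝y r⇝̸z) (lca-outside r⇝y r⇝x r⇝̸z))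

      hybrid-uncrossed : ∀ {h p q} → Gall r h p q → ¬ Crossed h
      hybrid-uncrossed K (z , x , h⇝x , z⇝x , h⇝̸z , z⇝̸h) =
        let (_ , _ , _ , _ , K′ , _ , h-side , _) = gall-of-incomparable h⇝̸z z⇝̸h h⇝x z⇝x
        in hybrid-not-on-side K K′ h-side

      -- Leaves attached to a gall with a single leaf below its hybrid

      module Hybrid {h} {a} (h⇝a : h ⇝ leaf a) (h-leaf : ∀ {x} → h ⇝ leaf x → x ≡ a) where

        -- The place of `x` on the gall: its lowest ancestor that also leads to the hybrid leaf.
        attach : Fin m → Fin k
        attach x = lca x a

        _≼_ : Fin m → Fin m → Set
        x ≼ y = attach x ⇝ attach y

        Attached : Fin k → Fin m → Set
        Attached p x = x ≢ a × attach x ∈⟨ r , p ]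

        module Side {p q} (K : Gall r h p q) where

          -- An ancestor `μ` of `y` incomparable with `attach y` would give a gall with `attach y`
          -- on a side, hence with the same hybrid `h`, and with `y` below that hybrid; but `a` is
          -- the only leaf below `h`.
          comparable : ∀ {y μ} → Attached p y → μ ⇝ leaf y → attach y ⇝ μ ⊎ μ ⇝ attach y
          comparable {y} {μ} (y≢a , y-side) μ⇝y with attach y ⇝? μ | μ ⇝? attach y
          ... | yes y⇝μ | _ = inj₁ y⇝μ
          ... | no _ | yes μ⇝y′ = inj₂ μ⇝y′
          ... | no y⇝̸μ | no μ⇝̸y =
            let (_ , _ , _ , _ , K′ , h′⇝y , y-side′ , _) =
                  gall-of-incomparable y⇝̸μ μ⇝̸y (lca⇝ˡ y a) μ⇝y
            in contradiction
                 (h-leaf (subst (_⇝ leaf y) (≡-sym (side-determines-hybrid K K′ y-side y-side′)) h′⇝y))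
                 y≢a

          -- Were the lca `μ` strictly below `attach x`, it would be crossed by a gall with top
          -- `r′`. Since `r` is lowest, `r′` lies strictly above `attach x`, so `attach x` is on a
          -- side of both galls and their hybrids agree. Then `μ` leads to `a`, so it is an ancestor
          -- of `attach x` after all.
          lca-upper : ∀ {x y} → Attached p x → Attached p y → x ≢ y → x ≼ y → lca x y ≡ attach x
          lca-upper {x} {y} X@(_ , x-side@(r⇝x , x⇝p , r≢x)) Y x≢y x≼y =
            antisym (decidable-stable (lca x y ⇝? attach x) below) x⇝μ
            where
            μ = lca x y
            x⇝μ : attach x ⇝ μ
            x⇝μ = lca-low (lca⇝ˡ x a) (x≼y ++ lca⇝ˡ y a)
            br : Branching μ
            br = x , y , x≢y , lca⇝ˡ x y , lca⇝ʳ x y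
            below : ¬ ¬ μ ⇝ attach x
            below μ⇝̸x =
              let r≢μ : r ≢ μ
                  r≢μ = λ { refl → r≢x (antisym r⇝x x⇝μ) }
                  (r′ , h′ , p′ , q′ , _ , _ , K′ , _ , (r′⇝μ , μ⇝p′ , _) , _ , br′ , top) =
                    crossing-gall br (below-crossed (r⇝x ++ x⇝μ) r≢μ br)
                  μ⇝̸a = λ μ⇝a → μ⇝̸x (lca-low (lca⇝ˡ x y) μ⇝a)
                  x⇝̸r′ = λ x⇝r′ → r≢x (antisym r⇝x
                           (subst (attach x ⇝_) (≡-sym (r-low r′ (br′ , inj₂ top) (r⇝x ++ x⇝r′))) x⇝r′))
              in [ x⇝̸r′
                 , (λ r′⇝x →
                     let h≡h′ = side-determines-hybrid K K′ x-side
                                  (r′⇝x , x⇝μ ++ μ⇝p′ , λ r′≡x → x⇝̸r′ (subst (attach x ⇝_) (≡-sym r′≡x) here))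
                     in μ⇝̸a (μ⇝p′ ++ edge (Gall.ph K′) ++ subst (_⇝ leaf a) h≡h′ h⇝a))
                 ]′ (comparable X (r′⇝μ ++ lca⇝ˡ x y))

          isSide : IsSide G a _≼_ (Attached p)
          isSide = record
            { side?   = λ x → ¬? (x ≟ a) ×-dec ((r ⇝? attach x) ×-dec (attach x ⇝? p) ×-dec ¬? (r ≟ attach x))
            ; ≢hybrid = proj₁
            ; ≼-total = λ { (_ , r⇝x , x⇝p , _) (_ , r⇝y , y⇝p , _) → side-chain K here r⇝x x⇝p y⇝p }
            ; upper   = λ { X@(x≢a , _) Y x≢y x≼y → adj-cong x≢y x≢a (lca-upper X Y x≢y x≼y) }
            }

          -- If `attach x` were above `lca z x`, it would be a common ancestor of `z` and `a`, hence
          -- above `attach z` and so above `r`, although it is strictly below `r`.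
          lca-homogeneous : ∀ {x z} → Attached p x → attach z ⇝ r → lca z x ≡ attach z
          lca-homogeneous {x} {z} X@(_ , r⇝x , _ , r≢x) z⇝r = antisym μ⇝z
              (lca-low (lca⇝ˡ z a) (z⇝r ++ r⇝x ++ lca⇝ˡ x a))
            where
            μ⇝z : lca z x ⇝ attach z
            μ⇝z with comparable X (lca⇝ʳ z x)
            ... | inj₂ μ⇝x = lca-low (lca⇝ˡ z x) (μ⇝x ++ lca⇝ʳ x a)
            ... | inj₁ x⇝μ = contradiction
                  (antisym r⇝x (lca-low (x⇝μ ++ lca⇝ˡ z x) (lca⇝ʳ x a) ++ z⇝r)) r≢x

          ⇝p-outside : ∀ {z} → z ≢ a → ¬ Attached p z → attach z ⇝ p → attach z ⇝ r
          ⇝p-outside {z} z≢a ¬Z z⇝p with side-chain K here here (Gall.r⇝p K) z⇝p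
          ... | inj₂ z⇝r = z⇝r
          ... | inj₁ r⇝z with r ≟ attach z
          ...   | yes r≡z = subst (_⇝ r) r≡z here
          ...   | no r≢z = contradiction (z≢a , r⇝z , z⇝p , r≢z) ¬Z

          cross⇝ : ∀ {x y} → Attached p x → Attached q y → lca x y ⇝ p
          cross⇝ {x} {y} X@(_ , r⇝x , x⇝p , r≢x) (_ , _ , y⇝q , _) with comparable X (lca⇝ˡ x y)
          ... | inj₂ μ⇝x = μ⇝x ++ x⇝p
          ... | inj₁ x⇝μ = contradiction (Gall.r-low K (attach x) x⇝p
                  (lca-low (x⇝μ ++ lca⇝ʳ x y) (lca⇝ʳ x a) ++ y⇝q) r⇝x) r≢x

      gallModule : TopOfGall r → GallModule G
      gallModule (h , p , q , a , x₀ , u , K , h⇝a , x₀≢a , (r⇝u , u⇝p , r≢u) , u⇝x₀) = record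
        { a = a ; _≼_ = _≼_ ; ≼-trans = _++_ ; Left = Attached p ; Right = Attached q
        ; left = P.isSide ; right = Q.isSide
        ; inhabited = x₀ , x₀≢a , r⇝u ++ u⇝z , x₀⇝p , λ r≡z →
            r≢u (antisym r⇝u (subst (u ⇝_) (≡-sym r≡z) u⇝z))
        ; disjoint = λ { (_ , r⇝x , x⇝p , r≢x) (_ , _ , x⇝q , _) → r≢x (r-low′ _ x⇝p x⇝q r⇝x) }
        ; colour = label r
        ; cross = λ X Y → trans (adj-lca (x≢y X Y)) (cong label (≡-sym (cross-lca X Y)))
        ; homogeneous = homogeneous
        }
        where
        open Gall K renaming (r-low to r-low′)
        r≢h : r ≢ h
        r≢h refl = acyclic _ _ ph r⇝p
        -- With two leaves below it, the uncrossed vertex `h` would be splitting and strictly below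
        -- `r`.
        h-leaf : ∀ {x} → h ⇝ leaf x → x ≡ a
        h-leaf {x} h⇝x = decidable-stable (x ≟ a) λ x≢a →
          r≢h (r-low h ((x , a , x≢a , h⇝x , h⇝a) , inj₁ (hybrid-uncrossed K)) (r⇝p ++ edge ph))
        open Hybrid h⇝a h-leaf
        module P = Side K
        module Q = Side (swap K)

        -- As an ancestor of `a`, `attach x` is comparable with the uncrossed `h`. It is not below
        -- `h`, so its path to `h` ends with one of the two parents.
        attach⇝ : ∀ {x} → x ≢ a → attach x ⇝ p ⊎ attach x ⇝ q
        attach⇝ {x} x≢a with attach x ⇝? h | h ⇝? attach x
        ... | _ | yes h⇝x = contradiction (h-leaf (h⇝x ++ lca⇝ˡ x a)) x≢a
        ... | no x⇝̸h | no h⇝̸x =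
              contradiction (attach x , a , h⇝a , lca⇝ʳ x a , h⇝̸x , x⇝̸h) (hybrid-uncrossed K)
        ... | yes x⇝h | no h⇝̸x with lastEdge x⇝h
        ...   | inj₁ x≡h = contradiction (subst (h ⇝_) (≡-sym x≡h) here) h⇝̸x
        ...   | inj₂ (w , x⇝w , wh) with third-parent p≢q ph qh wh
        ...     | inj₁ refl = inj₁ x⇝w
        ...     | inj₂ refl = inj₂ x⇝w

        u⇝z : u ⇝ attach x₀
        u⇝z = lca-low u⇝x₀ (u⇝p ++ edge ph ++ h⇝a)

        x₀⇝p : attach x₀ ⇝ p
        x₀⇝p with attach⇝ x₀≢a
        ... | inj₁ z⇝p = z⇝p
        ... | inj₂ z⇝q = contradiction (r-low′ u u⇝p (u⇝z ++ z⇝q) r⇝u) r≢u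

        x≢y : ∀ {x y} → Attached p x → Attached q y → x ≢ y
        x≢y (_ , r⇝x , x⇝p , r≢x) (_ , _ , x⇝q , _) refl = r≢x (r-low′ _ x⇝p x⇝q r⇝x)

        -- The lca reaches both `p` and `q`, so minimality of the top applies.
        cross-lca : ∀ {x y} → Attached p x → Attached q y → r ≡ lca x y
        cross-lca {x} {y} X Y = r-low′ _ (P.cross⇝ X Y)
          (lca-low (lca⇝ʳ x y) (lca⇝ˡ x y) ++ Q.cross⇝ Y X)
          (lca-low (proj₁ (proj₂ X) ++ lca⇝ˡ x a) (proj₁ (proj₂ Y) ++ lca⇝ˡ y a))

        homogeneous : ∀ {x z} → Attached p x ⊎ Attached q x → z ≢ a → ¬ Attached p z →
                      ¬ Attached q z → adj G z x ≡ adj G z a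
        homogeneous {x} {z} X z≢a ¬p ¬q = adj-cong
          (λ { refl → [ ¬p , ¬q ]′ X }) z≢a
          ([ (λ Xp → P.lca-homogeneous Xp z⇝r) , (λ Xq → Q.lca-homogeneous Xq z⇝r) ]′ X)
          where
          z⇝r : attach z ⇝ r
          z⇝r = [ P.⇝p-outside z≢a ¬p , Q.⇝p-outside z≢a ¬q ]′ (attach⇝ z≢a)

  -- The search starts at the root, which is comparable with every vertex and hence splitting.
  twins-or-gallModule : ∀ {m} {G : Graph (suc (suc m))} → Explains G →
                        (∃ λ x → ∃ λ y → Twins G x y) ⊎ GallModule G
  twins-or-gallModule {m} {G} X
    with lowest (splitting? X) {r = root}
           ((F.zero , F.suc F.zero , (λ ()) , root-⇝ _ , root-⇝ _) ,
            inj₁ λ { (z , _ , _ , _ , r⇝̸z , _) → r⇝̸z (root-⇝ z) })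
  ... | r , _ , ((x , y , x≢y , r⇝x , r⇝y) , how) , low with topOfGall? X r
  ...   | yes top = inj₂ (Lowest.gallModule X low top)
  ...   | no ¬top = inj₁ (x , y , Lowest.NotTop.twins X low
                            ([ id , (λ top → contradiction top ¬top) ]′ how) ¬top x≢y r⇝x r⇝y)

-- Contractions of trigraphs agreeing with a graph

tri : Bool → Colour
tri b = if b then black else none

merge-tri : ∀ {b c} → b ≡ c → merge (tri b) (tri c) ≡ tri b
merge-tri {true}  refl = refl
merge-tri {false} refl = refl

unmerge-tri : ∀ b c → isRed (merge (tri b) (tri c)) ≡ false → b ≡ c
unmerge-tri true  true  _ = refl
unmerge-tri false false _ = refl

-- On `P` the colour is arbitrary, so red is possible only there.
AgreesOff : (Fin n → Fin n → Set) → Trigraph n → Graph n → Set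
AgreesOff P T G = ∀ p q → ¬ P p q → T p q ≡ toTrigraph G p q

Agrees : Trigraph n → Graph n → Set
Agrees = AgreesOff (λ _ _ → ⊥)

Pair : Fin n → Fin n → Fin n → Fin n → Set
Pair x y p q = (p ≡ x × q ≡ y) ⊎ (p ≡ y × q ≡ x)

pair? : ∀ (x y p q : Fin n) → Dec (Pair x y p q)
pair? x y p q = ((p ≟ x) ×-dec (q ≟ y)) ⊎-dec ((p ≟ y) ×-dec (q ≟ x))

tri-not-red : ∀ b → isRed (tri b) ≢ true
tri-not-red true  ()
tri-not-red false ()

agrees⇒redDeg≤0 : ∀ {T : Trigraph n} G → Agrees T G → ∀ {d} → MaxRedDeg≤ d T
agrees⇒redDeg≤0 {T = T} G ag x =
  subst (_≤ _) (≡-sym (count≡0 (λ y → isRed (T x y)) λ y e →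
    tri-not-red (adj G x y) (trans (cong isRed (≡-sym (ag x y id))) e))) z≤n

agreesOffPair⇒redDeg≤1 : ∀ {T : Trigraph n} G {x a} → x ≢ a → AgreesOff (Pair x a) T G → MaxRedDeg≤ 1 T
agreesOffPair⇒redDeg≤1 {T = T} G {x} {a} x≢a ag p =
  count≤1 (λ q → isRed (T p q)) λ i j ri rj → unique (exceptional ri) (exceptional rj)
  where
  exceptional : ∀ {q} → isRed (T p q) ≡ true → Pair x a p q
  exceptional {q} r = decidable-stable (pair? x a p q) λ ¬pair →
    tri-not-red (adj G p q) (trans (cong isRed (≡-sym (ag p q ¬pair))) r)
  unique : ∀ {i j} → Pair x a p i → Pair x a p j → i ≡ j
  unique (inj₁ (_ , refl))    (inj₁ (_ , refl))    = refl
  unique (inj₁ (refl , _))    (inj₂ (x≡a , _))     = contradiction x≡a x≢a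
  unique (inj₂ (refl , _))    (inj₁ (a≡x , _))     = contradiction (≡-sym a≡x) x≢a
  unique (inj₂ (_ , refl))    (inj₂ (_ , refl))    = refl

contract-row : ∀ (T : Trigraph (suc m)) {u v} p q → punchIn v p ≡ u → punchIn v q ≢ u →
               contract T u v p q ≡ merge (T u (punchIn v q)) (T v (punchIn v q))
contract-row T {u} {v} p q p≡u q≢u
  rewrite dec-true (punchIn v p ≟ u) p≡u | dec-false (punchIn v q ≟ u) q≢u = refl

-- Exceptional entries are `P` before and `P′` after the contraction, both in the old numbering. The
-- vertices `u` and `v` need to agree only towards those `q` whose entry with `u` is not exceptional
-- afterwards, so they need not be twins.
contract-agreesOff : ∀ {T : Trigraph (suc m)} (G : Graph (suc m)) {P P′ : Fin (suc m) → Fin (suc m) → Set} u v →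
  AgreesOff P T G →
  (∀ p q → p ≢ v → q ≢ v → ¬ P′ p q → ¬ P p q) →
  (∀ q → q ≢ u → q ≢ v → ¬ P′ u q → ¬ P v q) →
  (∀ q → q ≢ u → q ≢ v → ¬ P′ q u → ¬ P q v) →
  (∀ q → q ≢ u → q ≢ v → ¬ P′ u q ⊎ ¬ P′ q u → adj G q u ≡ adj G q v) →
  u ≢ v →
  AgreesOff (λ p q → P′ (punchIn v p) (punchIn v q)) (contract T u v) (restrict G (punchIn v))
contract-agreesOff {T = T} G {P} {P′} u v ag other row col twin u≢v p q ¬P′
  with punchIn v p ≟ u | punchIn v q ≟ u | punchInᵢ≢i v p | punchInᵢ≢i v q
... | yes p≡u | yes q≡u | _ | _ = ≡-sym (cong tri
      (trans (cong₂ (adj G) p≡u q≡u) (irrefl G u)))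
... | no p≢u | no q≢u | p≢v | q≢v = ag _ _ (other _ _ p≢v q≢v ¬P′)
... | yes refl | no q≢u | p≢v | q≢v =
      trans (cong₂ merge (ag _ _ (other _ _ u≢v q≢v ¬P′)) (ag _ _ (row _ q≢u q≢v ¬P′)))
            (merge-tri (trans (sym G _ _) (trans (twin _ q≢u q≢v (inj₁ ¬P′)) (sym G _ _))))
... | no p≢u | yes refl | p≢v | q≢v =
      trans (cong₂ merge (ag _ _ (other _ _ p≢v u≢v ¬P′)) (ag _ _ (col _ p≢u p≢v ¬P′)))
            (merge-tri (twin _ p≢u p≢v (inj₂ ¬P′)))

contract-twins : ∀ {T : Trigraph (suc m)} G {u v} → Agrees T G → Twins G u v →
                 Agrees (contract T u v) (restrict G (punchIn v))
contract-twins {T = T} G {u = u} {v} ag (u≢v , twin) = contract-agreesOff {T = T} G {P = λ _ _ → ⊥} {P′ = λ _ _ → ⊥} u v ag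
  (λ _ _ _ _ _ → id) (λ _ _ _ _ → id) (λ _ _ _ _ → id) (λ q q≢u q≢v _ → twin q q≢u q≢v) u≢v

-- For sides, where `x ≼ y` puts `x` above `y`, this is a lowest leaf. Reflexivity comes from
-- totality with equal arguments.
least : ∀ {n} {P : Fin n → Set} {_≼_ : Fin n → Fin n → Set} → Decidable P →
        (∀ {x y} → P x → P y → x ≼ y ⊎ y ≼ x) → (∀ {x y z} → x ≼ y → y ≼ z → x ≼ z) →
        ∃ P → ∃ λ x → P x × (∀ y → P y → y ≼ x)
least {suc n} {P} {_≼_} P? total ≼-trans (x₀ , Px₀) with any? (P? ∘ F.suc) | P? F.zero
... | no none′ | no ¬P0 = ⊥-elim (nowhere x₀ Px₀)
  where
  nowhere : ∀ x → ¬ P x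
  nowhere F.zero    = ¬P0
  nowhere (F.suc x) = λ Px → none′ (x , Px)
... | no none′ | yes P0 = F.zero , P0 , λ
      { F.zero _ → reduce (total P0 P0) ; (F.suc x) Px → contradiction (x , Px) none′ }
... | yes tail | P0? with least {P = P ∘ F.suc} {_≼_ = λ x y → F.suc x ≼ F.suc y} (P? ∘ F.suc) total ≼-trans tail
...   | x , Px , least-x with P0?
...     | no ¬P0 = F.suc x , Px , λ { F.zero P0 → contradiction P0 ¬P0 ; (F.suc y) Py → least-x y Py }
...     | yes P0 with total P0 Px
...       | inj₁ 0≼x = F.suc x , Px , λ { F.zero _ → 0≼x ; (F.suc y) Py → least-x y Py }
...       | inj₂ x≼0 = F.zero , P0 , λ
            { F.zero _ → reduce (total P0 P0) ; (F.suc y) Py → ≼-trans (least-x y Py) x≼0 }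

-- Contracting the module below a gall

module CollapseGall {N M} {G : Graph N} (GM : GallModule G)
  (rest : ∀ {m} → m < M → (T : Trigraph (suc m)) (e : Fin (suc m) → Fin N) →
          (∀ {x y} → e x ≡ e y → x ≡ y) → Agrees T (restrict G e) → Collapses 1 T) where

  open GallModule GM
  module L = IsSide left
  module R = IsSide right

  -- Two left leaves can be told apart only by `a` or by a left leaf that is not above both.
  agree-left : ∀ {x y z} → Left x → Left y → z ≢ a → z ≢ x → z ≢ y →
               (Left z → z ≼ x × z ≼ y) → adj G z x ≡ adj G z y
  agree-left {x} {y} {z} Lx Ly z≢a z≢x z≢y upper with L.side? z | R.side? z
  ... | yes Lz | _ = let (z≼x , z≼y) = upper Lz
                     in trans (L.upper Lz Lx z≢x z≼x) (≡-sym (L.upper Lz Ly z≢y z≼y))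
  ... | no _ | yes Rz = trans (sym G z x) (trans (cross Lx Rz) (≡-sym (trans (sym G z y) (cross Ly Rz))))
  ... | no ¬Lz | no ¬Rz = trans (homogeneous (inj₁ Lx) z≢a ¬Lz ¬Rz)
                                (≡-sym (homogeneous (inj₁ Ly) z≢a ¬Lz ¬Rz))

  agree-right : ∀ {y z} → Right y → z ≢ a → z ≢ y → ¬ Left z → (Right z → z ≼ y) → adj G z a ≡ adj G z y
  agree-right {y} {z} Ry z≢a z≢y ¬Lz upper with R.side? z
  ... | yes Rz = ≡-sym (R.upper Rz Ry z≢y (upper Rz))
  ... | no ¬Rz = ≡-sym (homogeneous (inj₂ Ry) z≢a ¬Lz ¬Rz)

  -- At most the pair {x , a}, with x the lowest remaining left leaf, is red: the left side is
  -- contracted into x from below, then the right side into a from below, and finally a into x.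
  collapse : ∀ m → m ≤ M → (T : Trigraph (suc m)) (e : Fin (suc m) → Fin N) →
    (∀ {x y} → e x ≡ e y → x ≡ y) → ∀ x a′ → Left (e x) → e a′ ≡ a →
    (∀ y → Left (e y) → e y ≼ e x) → AgreesOff (Pair x a′) T (restrict G e) → Collapses 1 T
  collapse zero m≤M T e inj F.zero F.zero Lx a≡ _ _ = contradiction a≡ (L.≢hybrid Lx)
  collapse (suc m) m<M T e inj x a′ Lx refl low ag = go
    where
    H = restrict G e
    x≢a : x ≢ a′
    x≢a refl = L.≢hybrid Lx refl

    inj′ : ∀ v {x y} → e (punchIn v x) ≡ e (punchIn v y) → x ≡ y
    inj′ v eq = punchIn-injective v _ _ (inj eq)

    relabel : ∀ v {y b p q} (v≢y : v ≢ y) (v≢b : v ≢ b) →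
      Pair y b (punchIn v p) (punchIn v q) → Pair (punchOut v≢y) (punchOut v≢b) p q
    relabel v v≢y v≢b =
      Sum.map (λ (p , q) → back v≢y p , back v≢b q) (λ (p , q) → back v≢b p , back v≢y q)
      where
      back : ∀ {p z} (v≢z : v ≢ z) → punchIn v p ≡ z → p ≡ punchOut v≢z
      back v≢z eq = punchIn-injective v _ _ (trans eq (≡-sym (punchIn-punchOut v≢z)))

    step-to : ∀ u v → u ≢ v → ∀ y (v≢y : v ≢ y) (v≢a : v ≢ a′) → Left (e y) →
      (∀ z → z ≢ v → Left (e z) → e z ≼ e y) →
      AgreesOff (λ p q → Pair y a′ (punchIn v p) (punchIn v q)) (contract T u v) (restrict H (punchIn v)) →
      Collapses 1 T
    step-to u v u≢v y v≢y v≢a Ly low′ ag′ =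
      step T u v u≢v (agreesOffPair⇒redDeg≤1 (restrict H (punchIn v)) y≢a ag″)
        (collapse m (ℕ.<⇒≤ m<M) (contract T u v) (e ∘ punchIn v) (inj′ v)
          (punchOut v≢y) (punchOut v≢a)
          (subst (Left ∘ e) (≡-sym (punchIn-punchOut v≢y)) Ly)
          (cong e (punchIn-punchOut v≢a))
          (λ z Lz → subst (λ y → e (punchIn v z) ≼ e y) (≡-sym (punchIn-punchOut v≢y))
                      (low′ (punchIn v z) (punchInᵢ≢i v z) Lz))
          ag″)
      where
      ag″ : AgreesOff (Pair (punchOut v≢y) (punchOut v≢a)) (contract T u v) (restrict H (punchIn v))
      ag″ p q ¬pair = ag′ p q (¬pair ∘ relabel v v≢y v≢a)
      y≢a : punchOut v≢y ≢ punchOut v≢a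
      y≢a eq = L.≢hybrid Ly (cong e (trans (≡-sym (punchIn-punchOut v≢y))
                 (trans (cong (punchIn v) eq) (punchIn-punchOut v≢a))))

    go : Collapses 1 T
    go with any? (λ y → ¬? (y ≟ x) ×-dec L.side? (e y)) | any? (λ y → R.side? (e y))
    -- The lowest left leaf `x` is merged with the next one, `y`. Only `a` can tell them apart, so
    -- the exceptional pair moves to `y` and `a`.
    ... | yes more | _
      with least {P = λ y → y ≢ x × Left (e y)} {_≼_ = λ y z → e y ≼ e z}
             (λ y → ¬? (y ≟ x) ×-dec L.side? (e y))
             (λ (_ , Ly) (_ , Lz) → L.≼-total Ly Lz) ≼-trans more
    ...   | y , (y≢x , Ly) , low-y = step-to y x y≢x y (y≢x ∘ ≡-sym) x≢a Ly
            (λ z z≢x Lz → low-y z (z≢x , Lz))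
            (contract-agreesOff {T = T} H {P = Pair x a′} {P′ = Pair y a′} y x ag
              (λ { p q p≢x q≢x _ (inj₁ (p≡x , _)) → p≢x p≡x ; p q p≢x q≢x _ (inj₂ (_ , q≡x)) → q≢x q≡x })
              (λ { q q≢y q≢x ¬P (inj₁ (_ , q≡a)) → ¬P (inj₁ (refl , q≡a)) ; q q≢y q≢x ¬P (inj₂ (x≡a , _)) → x≢a x≡a })
              (λ { q q≢y q≢x ¬P (inj₁ (_ , x≡a)) → x≢a x≡a ; q q≢y q≢x ¬P (inj₂ (q≡a , _)) → ¬P (inj₂ (q≡a , refl)) })
              (λ q q≢y q≢x ¬P → agree-left Ly Lx
                (λ eq → [ (λ ¬P → ¬P (inj₁ (refl , inj eq))) , (λ ¬P → ¬P (inj₂ (inj eq , refl))) ]′ ¬P)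
                (q≢y ∘ inj) (q≢x ∘ inj) λ Lq → low-y q (q≢x , Lq) , low q Lq)
              y≢x)
    -- Only `x` is left of the left side. The lowest right leaf `y` and `a` can differ only towards
    -- `x`, so the exceptional pair stays in place.
    go | no ¬more | yes more
      with least {P = λ y → Right (e y)} {_≼_ = λ y z → e y ≼ e z}
             (λ y → R.side? (e y)) R.≼-total ≼-trans more
    ...   | y , Ry , low-y = step-to a′ y a≢y x y≢x (a≢y ∘ ≡-sym) Lx (λ z _ Lz → low z Lz)
            (contract-agreesOff {T = T} H {P = Pair x a′} {P′ = Pair x a′} a′ y ag
              (λ p q _ _ ¬P → ¬P)
              (λ { q q≢a q≢y ¬P (inj₁ (y≡x , _)) → y≢x y≡x ; q q≢a q≢y ¬P (inj₂ (y≡a , _)) → a≢y (≡-sym y≡a) })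
              (λ { q q≢a q≢y ¬P (inj₁ (_ , y≡a)) → a≢y (≡-sym y≡a) ; q q≢a q≢y ¬P (inj₂ (_ , y≡x)) → y≢x y≡x })
              (λ q q≢a q≢y ¬P → agree-right Ry (q≢a ∘ inj) (q≢y ∘ inj)
                (λ Lq → ¬more (q , (λ { refl → [ (λ ¬P → ¬P (inj₂ (refl , refl))) , (λ ¬P → ¬P (inj₁ (refl , refl))) ]′ ¬P }) , Lq))
                (low-y q))
              a≢y)
      where
      a≢y : a′ ≢ y
      a≢y refl = R.≢hybrid Ry refl
      y≢x : y ≢ x
      y≢x refl = disjoint Lx Ry
    -- The module has shrunk to `x` and `a`, which are homogeneous to all other vertices; merging
    -- them removes the exceptional pair.
    go | no ¬left | no ¬right = step T x a′ x≢a (agrees⇒redDeg≤0 (restrict H (punchIn a′)) ag′)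
      (rest m<M (contract T x a′) (e ∘ punchIn a′) (inj′ a′) ag′)
      where
      ag′ : Agrees (contract T x a′) (restrict H (punchIn a′))
      ag′ = contract-agreesOff {T = T} H {P = Pair x a′} {P′ = λ _ _ → ⊥} x a′ ag
        (λ { p q _ q≢a _ (inj₁ (_ , q≡a)) → q≢a q≡a ; p q p≢a _ _ (inj₂ (p≡a , _)) → p≢a p≡a })
        (λ { q q≢x q≢a _ (inj₁ (_ , q≡a)) → q≢a q≡a ; q q≢x q≢a _ (inj₂ (_ , q≡x)) → q≢x q≡x })
        (λ { q q≢x q≢a _ (inj₁ (q≡x , _)) → q≢x q≡x ; q q≢x q≢a _ (inj₂ (q≡a , _)) → q≢a q≡a })
        (λ q q≢x q≢a _ → homogeneous (inj₁ Lx) (q≢a ∘ inj)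
          (λ Lq → ¬left (q , q≢x , Lq)) (λ Rq → ¬right (q , Rq)))
        x≢a

-- Cographs

both-≢ : ∀ {b c d : Bool} → b ≢ d → c ≢ d → b ≡ c
both-≢ b≢d c≢d = trans (Bool.¬-not b≢d) (≡-sym (Bool.¬-not c≢d))

-- If adj x x̄ ≢ ρ then the ρ-coloured pairs among x̄, y, x, a form the path x̄ y x a;
-- since P₄ is self-complementary, this is an induced P₄ for either value of ρ.
cograph-adj : ∀ {G : Graph n} {x x̄ y a ρ} → IsCograph G → adj G x y ≡ ρ → adj G x̄ y ≡ ρ →
              adj G x a ≡ ρ → adj G x̄ a ≢ ρ → adj G y a ≢ ρ → adj G x x̄ ≡ ρ
cograph-adj {G = G} {x} {x̄} {y} {a} {ρ} ¬P4 xy x̄y xa x̄a ya =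
  decidable-stable (adj G x x̄ Bool.≟ ρ) λ xx̄ → induced ρ refl xx̄
  where
  induced : ∀ c → ρ ≡ c → adj G x x̄ ≢ ρ → ⊥
  induced true refl xx̄ = ¬P4 (x̄ , y , x , a , x̄y , trans (sym G y x) xy , xa ,
    trans (sym G x̄ x) (Bool.¬-not xx̄) , Bool.¬-not ya , Bool.¬-not x̄a)
  induced false refl xx̄ = ¬P4 (x , x̄ , a , y , Bool.¬-not xx̄ , Bool.¬-not x̄a ,
    trans (sym G a y) (Bool.¬-not ya) , xa , x̄y , xy)

module CographTwins {n} {G : Graph n} (GM : GallModule G) (cograph : IsCograph G) where
  open GallModule GM
  module L = IsSide left
  module R = IsSide right

  module Deviant {S} (side : IsSide G a _≼_ S) {y} (ya : adj G y a ≢ colour)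
                 (S-y : ∀ {x} → S x → adj G x y ≡ colour) where
    open IsSide side

    -- If `z` has the cross colour towards `a`, absence of a P₄ on `z`, `x`, `y`, `a` forces that
    -- colour between `z` and `x`. Otherwise `x` and `z` have the same adjacency to `a`, and the
    -- upper one passes it on.
    like-hybrid : ∀ {x z} → S x → adj G x a ≢ colour → S z → z ≢ x → adj G z x ≡ adj G z a
    like-hybrid {x} {z} Sx xa Sz z≢x with adj G z a Bool.≟ colour
    ... | yes za = trans (cograph-adj {G = G} cograph (S-y Sz) (S-y Sx) za xa ya) (≡-sym za)
    ... | no za with ≼-total Sz Sx
    ...   | inj₁ z≼x = upper Sz Sx z≢x z≼x
    ...   | inj₂ x≼z = trans (sym G z x) (trans (upper Sx Sz (z≢x ∘ ≡-sym) x≼z) (both-≢ xa za))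

    two-twins : ∀ {x x′} → x ≢ x′ → S x → S x′ → adj G x a ≢ colour → adj G x′ a ≢ colour →
      (∀ {z} → z ≢ a → ¬ S z → adj G z x ≡ adj G z x′) → Twins G x x′
    two-twins {x} {x′} x≢x′ Sx Sx′ xa x′a other = x≢x′ , agree
      where
      agree : ∀ z → z ≢ x → z ≢ x′ → adj G z x ≡ adj G z x′
      agree z z≢x z≢x′ with z ≟ a | side? z
      ... | yes refl | _ = trans (sym G a x) (trans (both-≢ xa x′a) (sym G x′ a))
      ... | no z≢a | no ¬Sz = other z≢a ¬Sz
      ... | no _ | yes Sz = trans (like-hybrid Sx xa Sz z≢x) (≡-sym (like-hybrid Sx′ x′a Sz z≢x′))

  lowest-left-twin : (∀ {y} → Right y → adj G y a ≡ colour) → ∃ λ x → Twins G x a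
  lowest-left-twin right≡ with least L.side? L.≼-total ≼-trans inhabited
  ... | x , Lx , low = x , L.≢hybrid Lx , agree
    where
    agree : ∀ z → z ≢ x → z ≢ a → adj G z x ≡ adj G z a
    agree z z≢x z≢a with L.side? z | R.side? z
    ... | yes Lz | _ = L.upper Lz Lx z≢x (low z Lz)
    ... | no _ | yes Rz = trans (sym G z x) (trans (cross Lx Rz) (≡-sym (right≡ Rz)))
    ... | no ¬Lz | no ¬Rz = homogeneous (inj₁ Lx) z≢a ¬Lz ¬Rz

  lowest-right-twin : ∃ Right → (∀ {x} → Left x → adj G x a ≡ colour) → ∃ λ y → Twins G a y
  lowest-right-twin inh left≡ with least R.side? R.≼-total ≼-trans inh
  ... | y , Ry , low = y , R.≢hybrid Ry ∘ ≡-sym , agree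
    where
    agree : ∀ z → z ≢ a → z ≢ y → adj G z a ≡ adj G z y
    agree z z≢a z≢y with L.side? z | R.side? z
    ... | yes Lz | _ = trans (left≡ Lz) (≡-sym (cross Lz Ry))
    ... | no _ | yes Rz = ≡-sym (R.upper Rz Ry z≢y (low z Rz))
    ... | no ¬Lz | no ¬Rz = ≡-sym (homogeneous (inj₂ Ry) z≢a ¬Lz ¬Rz)

  -- Call a leaf of a side deviant if its adjacency to `a` is not the cross colour. If some side has
  -- no deviant leaf, `a` has a twin; two deviant leaves on one side are twins; and if each side has
  -- exactly one, these two are twins.
  twins : ∃ λ x → ∃ λ y → Twins G x y
  twins with any? (λ y → R.side? y ×-dec ¬? (adj G y a Bool.≟ colour))
           | any? (λ x → L.side? x ×-dec ¬? (adj G x a Bool.≟ colour))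
  ... | no ¬∃ | _ = let (x , tw) = lowest-left-twin λ {y} Ry →
                          decidable-stable (adj G y a Bool.≟ colour) λ ya → ¬∃ (y , Ry , ya)
                    in x , a , tw
  ... | yes (y , Ry , _) | no ¬∃ = a , lowest-right-twin (y , Ry) λ {x} Lx →
          decidable-stable (adj G x a Bool.≟ colour) λ xa → ¬∃ (x , Lx , xa)
  ... | yes (y , Ry , ya) | yes (x , Lx , xa)
    with any? (λ x′ → ¬? (x ≟ x′) ×-dec L.side? x′ ×-dec ¬? (adj G x′ a Bool.≟ colour))
       | any? (λ y′ → ¬? (y ≟ y′) ×-dec R.side? y′ ×-dec ¬? (adj G y′ a Bool.≟ colour))
  ... | yes (x′ , x≢x′ , Lx′ , x′a) | _ =
        x , x′ , Deviant.two-twins left ya (λ Lz → cross Lz Ry) x≢x′ Lx Lx′ xa x′a other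
    where
    other : ∀ {z} → z ≢ a → ¬ Left z → adj G z x ≡ adj G z x′
    other {z} z≢a ¬Lz with R.side? z
    ... | yes Rz = trans (sym G z x) (trans (cross Lx Rz) (trans (≡-sym (cross Lx′ Rz)) (sym G x′ z)))
    ... | no ¬Rz = trans (homogeneous (inj₁ Lx) z≢a ¬Lz ¬Rz) (≡-sym (homogeneous (inj₁ Lx′) z≢a ¬Lz ¬Rz))
  ... | no _ | yes (y′ , y≢y′ , Ry′ , y′a) =
        y , y′ , Deviant.two-twins right xa (λ {z} Rz → trans (sym G z x) (cross Lx Rz))
                   y≢y′ Ry Ry′ ya y′a other
    where
    other : ∀ {z} → z ≢ a → ¬ Right z → adj G z y ≡ adj G z y′
    other {z} z≢a ¬Rz with L.side? z
    ... | yes Lz = trans (cross Lz Ry) (≡-sym (cross Lz Ry′))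
    ... | no ¬Lz = trans (homogeneous (inj₂ Ry) z≢a ¬Lz ¬Rz) (≡-sym (homogeneous (inj₂ Ry′) z≢a ¬Lz ¬Rz))
  ... | no ¬x′ | no ¬y′ = x , y , (λ { refl → disjoint Lx Ry }) , agree
    where
    agree : ∀ z → z ≢ x → z ≢ y → adj G z x ≡ adj G z y
    agree z z≢x z≢y with z ≟ a | L.side? z | R.side? z
    ... | yes refl | _ | _ = trans (sym G a x) (trans (both-≢ xa ya) (sym G y a))
    ... | no _ | yes Lz | _ = trans (Deviant.like-hybrid left ya (λ Lz → cross Lz Ry) Lx xa Lz z≢x)
            (trans (decidable-stable (adj G z a Bool.≟ colour) λ za → ¬x′ (z , z≢x ∘ ≡-sym , Lz , za))
                   (≡-sym (cross Lz Ry)))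
    ... | no _ | no _ | yes Rz = ≡-sym
            (trans (Deviant.like-hybrid right xa (λ {z} Rz → trans (sym G z x) (cross Lx Rz)) Ry ya Rz z≢y)
            (trans (decidable-stable (adj G z a Bool.≟ colour) λ za → ¬y′ (z , z≢y ∘ ≡-sym , Rz , za))
                   (≡-sym (trans (sym G z x) (cross Lx Rz)))))
    ... | no z≢a | no ¬Lz | no ¬Rz = trans (homogeneous (inj₁ Lx) z≢a ¬Lz ¬Rz)
                                           (≡-sym (homogeneous (inj₂ Ry) z≢a ¬Lz ¬Rz))


-- An induced P₄ contains no twins, so it survives the replacement of v by its twin u.
cograph-lift : ∀ (G : Graph (suc n)) {u v} → Twins G u v → IsCograph (restrict G (punchIn v)) → IsCograph G
cograph-lift {n = n} G {u} {v} (u≢v , twin) cograph (a , b , c , d , ab , bc , cd , ac , bd , ad) =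
  -- For each pair of path vertices, a third one adjacent to exactly one of them shows that they are
  -- not twins.
  cograph (out a , out b , out c , out d
    , kept (true≢false cb ca ∘ ≡-sym) (≢-by cd ad) (edge≢ cb) ab
    , kept (true≢false ab ac) (edge≢ ab) (≢-by cd ad ∘ ≡-sym) bc
    , kept (true≢false bc bd) (edge≢ bc) (≢-by ba da) cd
    , kept (true≢false dc da ∘ ≡-sym) (≢-by dc ac) (edge≢ dc) ac
    , kept (true≢false ab ad) (edge≢ ab) (≢-by dc ac ∘ ≡-sym) bd
    , kept (true≢false ba bd) (edge≢ ba) (≢-by ba da) ad)
  where
  ba = trans (sym G b a) ab
  cb = trans (sym G c b) bc
  dc = trans (sym G d c) cd
  ca = trans (sym G c a) ac
  da = trans (sym G d a) ad

  true≢false : ∀ {b c : Bool} → b ≡ true → c ≡ false → b ≢ c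
  true≢false refl refl ()

  ≢-by : ∀ {x y w} → adj G x w ≡ true → adj G y w ≡ false → x ≢ y
  ≢-by xw yw refl = true≢false xw yw refl

  edge≢ : ∀ {x y} → adj G x y ≡ true → x ≢ y
  edge≢ {x} xy refl = true≢false xy (irrefl G x) refl

  φ : ∀ x → ∃ λ y → v ≢ y × ((x ≡ v × y ≡ u) ⊎ x ≡ y)
  φ x with x ≟ v
  ... | yes x≡v = u , u≢v ∘ ≡-sym , inj₁ (x≡v , refl)
  ... | no x≢v  = x , x≢v ∘ ≡-sym , inj₂ refl

  out : Fin (suc n) → Fin n
  out x = punchOut (proj₁ (proj₂ (φ x)))

  -- A vertex `z` telling `v` and `y` apart shows that `y` is not the twin `u`, so `u` and `v` agree
  -- towards `y`.
  twin-row : ∀ {y z} → adj G z v ≢ adj G z y → z ≢ v → z ≢ y → v ≢ y → adj G u y ≡ adj G v y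
  twin-row {y} {z} dis z≢v z≢y v≢y = trans (sym G u y) (trans (twin y y≢u (v≢y ∘ ≡-sym)) (sym G y v))
    where
    y≢u : y ≢ u
    y≢u refl = dis (≡-sym (twin z z≢y z≢v))

  φ-adj : ∀ {x y z} → adj G z x ≢ adj G z y → z ≢ x → z ≢ y →
          adj G (proj₁ (φ x)) (proj₁ (φ y)) ≡ adj G x y
  φ-adj {x} {y} dis z≢x z≢y with φ x | φ y
  ... | _ , _ , inj₁ (refl , refl) | _ , _ , inj₁ (refl , refl) = trans (irrefl G u) (≡-sym (irrefl G v))
  ... | _ , _ , inj₁ (refl , refl) | _ , v≢y , inj₂ refl = twin-row dis z≢x z≢y v≢y
  ... | _ , v≢x , inj₂ refl | _ , _ , inj₁ (refl , refl) =
        trans (sym G x u) (trans (twin-row (dis ∘ ≡-sym) z≢y z≢x v≢x) (sym G v x))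
  ... | _ , _ , inj₂ refl | _ , _ , inj₂ refl = refl

  kept : ∀ {x y z b} → adj G z x ≢ adj G z y → z ≢ x → z ≢ y → adj G x y ≡ b →
         adj G (punchIn v (out x)) (punchIn v (out y)) ≡ b
  kept {x} {y} dis z≢x z≢y xy = trans
    (cong₂ (adj G) (punchIn-punchOut (proj₁ (proj₂ (φ x)))) (punchIn-punchOut (proj₁ (proj₂ (φ y)))))
    (trans (φ-adj dis z≢x z≢y) xy)

-- Contraction sequences without red edges

redDeg≤0⇒twins : ∀ {T : Trigraph (suc m)} (G : Graph (suc m)) {u v} → Agrees T G → u ≢ v →
                 MaxRedDeg≤ 0 (contract T u v) → Twins G u v
redDeg≤0⇒twins {T = T} G {u} {v} ag u≢v red≤0 = u≢v , agree
  where
  agree : ∀ z → z ≢ u → z ≢ v → adj G z u ≡ adj G z v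
  agree z z≢u z≢v = trans (sym G z u) (trans
    (unmerge-tri (adj G u z) (adj G v z) (Bool.¬-not not-red)) (sym G v z))
    where
    p = punchOut (u≢v ∘ ≡-sym)
    q = punchOut (z≢v ∘ ≡-sym)
    p≡ : punchIn v p ≡ u
    p≡ = punchIn-punchOut _
    q≡ : punchIn v q ≡ z
    q≡ = punchIn-punchOut _
    entry : contract T u v p q ≡ merge (tri (adj G u z)) (tri (adj G v z))
    entry = trans (contract-row T p q p≡ (z≢u ∘ trans (≡-sym q≡)))
      (cong₂ merge (trans (cong (T u) q≡) (ag u z id)) (trans (cong (T v) q≡) (ag v z id)))
    not-red : isRed (merge (tri (adj G u z)) (tri (adj G v z))) ≢ true
    not-red r with ℕ.≤-trans (1≤count (λ y → isRed (contract T u v p y)) (trans (cong isRed entry) r)) (red≤0 p)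
    ... | ()

-- Without red edges every step contracts twins of an ordinary graph, so P₄-freeness lifts back from
-- the single vertex.
collapses₀⇒cograph : ∀ {T : Trigraph (suc m)} G → Agrees T G → Collapses 0 T → IsCograph G
collapses₀⇒cograph G ag (done T) (F.zero , F.zero , _ , _ , ab , _) =
  contradiction (trans (≡-sym ab) (irrefl G F.zero)) λ ()
collapses₀⇒cograph G ag (step T u v u≢v red≤0 rest) = cograph-lift G tw
  (collapses₀⇒cograph (restrict G (punchIn v)) (contract-twins G ag tw) rest)
  where
  tw : Twins G u v
  tw = redDeg≤0⇒twins G ag u≢v red≤0

cograph-restrict : ∀ (G : Graph n) (e : Fin m → Fin n) → IsCograph G → IsCograph (restrict G e)
cograph-restrict G e cograph (a , b , c , d , P4) = cograph (e a , e b , e c , e d , P4)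

-- Collapsing GaTEx graphs

module Collapse {n k} {E : Digraph k} {ℓ : Fin n → Fin k} (N : IsGalledTreeGeneral E ℓ) where
  open Explanation N

  -- The recursion is on accessibility because a gall may consume many vertices before the induction
  -- hypothesis is used again.
  explained⇒collapses₁ : ∀ m → Acc _<_ m → (T : Trigraph (suc m)) (G : Graph (suc m)) → Explains G →
                         Agrees T G → Collapses 1 T
  explained⇒collapses₁ zero    _        T G X ag = done T
  explained⇒collapses₁ (suc m) (acc rs) T G X ag = [ viaTwins , viaGall ]′ (twins-or-gallModule X)
    where
    viaTwins : (∃ λ u → ∃ λ v → Twins G u v) → Collapses 1 T
    viaTwins (u , v , tw) = step T u v (proj₁ tw) (agrees⇒redDeg≤0 (restrict G (punchIn v)) ag′)
        (explained⇒collapses₁ m (rs ℕ.≤-refl) (contract T u v) (restrict G (punchIn v))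
          (explains-restrict (punchIn v) (punchIn-injective v _ _) X) ag′)
      where
      ag′ : Agrees (contract T u v) (restrict G (punchIn v))
      ag′ = contract-twins G ag tw

    viaGall : GallModule G → Collapses 1 T
    viaGall GM = from (least L.side? L.≼-total ≼-trans inhabited)
      where
      open GallModule GM
      module L = IsSide left
      rest : ∀ {m′} → m′ < suc m → (T : Trigraph (suc m′)) (e : Fin (suc m′) → Fin (suc (suc m))) →
             (∀ {x y} → e x ≡ e y → x ≡ y) → Agrees T (restrict G e) → Collapses 1 T
      rest {m′} m′< T′ e inj ag′ =
        explained⇒collapses₁ m′ (rs m′<) T′ (restrict G e) (explains-restrict e inj X) ag′
      from : (∃ λ x → Left x × (∀ y → Left y → y ≼ x)) → Collapses 1 T
      from (x , Lx , low) = CollapseGall.collapse GM rest (suc m) ℕ.≤-refl T id id x a Lx refl low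
                              (λ p q _ → ag p q id)

  explained-cograph⇒collapses₀ : ∀ m (T : Trigraph (suc m)) (G : Graph (suc m)) → Explains G →
                                 IsCograph G → Agrees T G → Collapses 0 T
  explained-cograph⇒collapses₀ zero    T G X cograph ag = done T
  explained-cograph⇒collapses₀ (suc m) T G X cograph ag =
    viaTwins ([ id , (λ GM → CographTwins.twins GM cograph) ]′ (twins-or-gallModule X))
    where
    viaTwins : (∃ λ u → ∃ λ v → Twins G u v) → Collapses 0 T
    viaTwins (u , v , tw) = step T u v (proj₁ tw) (agrees⇒redDeg≤0 (restrict G (punchIn v)) ag′)
        (explained-cograph⇒collapses₀ m (contract T u v) (restrict G (punchIn v))
          (explains-restrict (punchIn v) (punchIn-injective v _ _) X)
          (cograph-restrict G (punchIn v) cograph) ag′)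
      where
      ag′ : Agrees (contract T u v) (restrict G (punchIn v))
      ag′ = contract-twins G ag tw

-- From labeled galled-trees to explained graphs

isL1 : Label → Bool
isL1 l1 = true
isL1 _  = false

isL1-⇔ : ∀ {b l} → (b ≡ true) ⇔ (l ≡ l1) → b ≡ isL1 l
isL1-⇔ {true}  eq with Equivalence.to eq refl
... | refl = refl
isL1-⇔ {false} {l0} eq = refl
isL1-⇔ {false} {l1} eq = Equivalence.from eq refl
isL1-⇔ {false} {⊙}  eq = refl

gatex⇒explains : ∀ {k} {E : Digraph k} {ℓ : Fin n → Fin k} (N : IsGalledTreeGeneral E ℓ)
  (G : Graph n) (t : Fin k → Label) →
  (∀ x y → x ≢ y → Σ (Fin k) λ w → IsLca E (ℓ x) (ℓ y) w × ((adj G x y ≡ true) ⇔ (t w ≡ l1))) →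
  Explanation.Explains N G
gatex⇒explains {n = n} {k = k} {E} {ℓ} N G t explained = record
  { leaf    = ℓ
  ; lca     = λ x y → proj₁ (total x y)
  ; lca⇝ˡ   = λ x y → proj₁ (proj₂ (total x y))
  ; lca⇝ʳ   = λ x y → proj₁ (proj₂ (proj₂ (total x y)))
  ; lca-low = λ {x} {y} → proj₁ (proj₂ (proj₂ (proj₂ (total x y)))) _
  ; label   = isL1 ∘ t
  ; adj-lca = λ {x} {y} → proj₂ (proj₂ (proj₂ (proj₂ (total x y))))
  }
  where
  open IsGalledTreeGeneral N using (acyclic)
  open Dag E acyclic
  total : ∀ x y → Σ (Fin k) λ w → w ⇝ ℓ x × w ⇝ ℓ y × (∀ z → z ⇝ ℓ x → z ⇝ ℓ y → z ⇝ w) ×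
                    (x ≢ y → adj G x y ≡ isL1 (t w))
  total x y with x ≟ y
  -- On the diagonal the leaf itself serves as lca, and the adjacency condition is vacuous.
  ... | yes refl = ℓ x , here , here , (λ _ z⇝x _ → z⇝x) , contradiction refl
  ... | no x≢y with explained x y x≢y
  ...   | w , ((w⇝x , w⇝y , _) , unique) , eq = w , w⇝x , w⇝y , low , λ _ → isL1-⇔ eq
    where
    -- Below any common ancestor `z` there is a minimal one, which is `w` by uniqueness.
    low : ∀ z → z ⇝ ℓ x → z ⇝ ℓ y → z ⇝ w
    low z z⇝x z⇝y with lowest {P = λ v → v ⇝ ℓ x × v ⇝ ℓ y} (λ v → (v ⇝? ℓ x) ×-dec (v ⇝? ℓ y)) (z⇝x , z⇝y)
    ... | v , z⇝v , (v⇝x , v⇝y) , min =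
          subst (z ⇝_) (unique v (v⇝x , v⇝y , λ v′ x′ y′ v⇝v′ → ≡-sym (min v′ (x′ , y′) v⇝v′))) z⇝v

gatex-collapses : ∀ (G : Graph (suc n)) → IsGaTEx G →
  Collapses 1 (toTrigraph G) × (IsCograph G → Collapses 0 (toTrigraph G))
gatex-collapses {zero} G _ = done _ , λ _ → done _
-- The trivial network has a single leaf, so it cannot explain a graph with two or more vertices.
gatex-collapses {suc n} G (k , E , ℓ , t , _ , inj₁ (_ , () , _) , _)
gatex-collapses {suc n} G (k , E , ℓ , t , _ , inj₂ N , _ , explained) =
  explained⇒collapses₁ _ (<-wellFounded _) _ G X (λ _ _ _ → refl) ,
  λ cograph → explained-cograph⇒collapses₀ _ _ G X cograph (λ _ _ _ → refl)
  where
  open Collapse N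
  X = gatex⇒explains N G t explained

mainTheorem18 : ∀ {n} (G : Graph (suc n)) → IsGaTEx G →
    Collapsible 1 G × (TwinWidthIs G 1 ⇔ (¬ IsCograph G))
mainTheorem18 G gatex = collapsible₁ , mk⇔
  (λ (_ , least-1) cograph → least-1 0 (s≤s z≤n)
     (agrees⇒redDeg≤0 G (λ _ _ _ → refl) , proj₂ (gatex-collapses G gatex) cograph))
  (λ ¬cograph → collapsible₁ , λ { zero _ (_ , collapses₀) →
                                     ¬cograph (collapses₀⇒cograph G (λ _ _ _ → refl) collapses₀)
                                 ; (suc _) (s≤s ()) _ })
  where
  collapsible₁ : Collapsible 1 G
  collapsible₁ = agrees⇒redDeg≤0 G (λ _ _ _ → refl) , proj₁ (gatex-collapses G gatex)
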